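{- Let $p=3$ and let $\Phi:U^{(1)}-U^{(2)}\to 3\mathbb{Z}_3\cup(1+3\mathbb{Z}_3)$ be the fixed-point homeomorphism, which takes $4+9\mathbb{Z}_3$ onto $1+3\mathbb{Z}_3$ and $7+9\mathbb{Z}_3$ onto $3\mathbb{Z}_3$. Define $F,G:\mathbb{Z}_3\to\mathbb{Z}_3$ by $$F(x)=\tfrac13\big(\Phi(4+9x)-1\big),\qquad G(x)=\tfrac13\,\Phi(7+9x).$$ Then $F$ and $G$ are isometries of $\mathbb{Z}_3$ with its $3$-adic metric.
   Context: $\mathbb{Z}_3$ is the ring of $3$-adic integers, $U^{(m)}=1+3^m\mathbb{Z}_3$, so $U^{(1)}-U^{(2)}=(4+9\mathbb{Z}_3)\cup(7+9\mathbb{Z}_3)$. For $q\in U^{(1)}$, $\iota_q:\mathbb{Z}_3\to\mathbb{Z}_3$ is the unique continuous function with $\iota_q(n)=1+q+\cdots+q^{n-1}$ for all integers $n\ge 0$; thus $\iota_q(z)=(q^z-1)/(q-1)$ for $q\ne 1$. The fixed points $0,1$ of $\iota_q$ are called trivial. There are unique elements $q_0\equiv 7\pmod 9$ and $q_1\equiv 4\pmod 9$ in $U^{(1)}-U^{(2)}$ such that $\iota_{q_0},\iota_{q_1}$ have no nontrivial fixed points in $\mathbb{Z}_3$; every other $q\in U^{(1)}-U^{(2)}$ has exactly one nontrivial fixed point $z_q\in\mathbb{Z}_3$. The map $\Phi$ is defined by $\Phi(q)=z_q$ for $q\notin\{q_0,q_1\}$, $\Phi(q_0)=0$, $\Phi(q_1)=1$;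 it is a homeomorphism onto $3\mathbb{Z}_3\cup(1+3\mathbb{Z}_3)$ with the mapping properties stated (results of the same paper). An isometry is a (surjective) distance-preserving map. -}

module Defs where

open import Algebra.Bundles using (CommutativeRing; Semiring)
open import Algebra.Bundles.Raw using (RawSemiring)
open import Algebra.Definitions.RawMagma using (_,_)
import Algebra.Definitions.RawSemiring as RawSemiringDefs
open import Data.Integer as ℤ using (ℤ; +_)
open import Data.Integer.Divisibility.Signed as ℤ∣ using (divides)
import Data.Integer.DivMod as ℤ
import Data.Integer.Properties as ℤ
open import Data.Integer.Tactic.RingSolver using (solve-∀)
open import Data.Nat as ℕ using (ℕ; zero; suc)
import Data.Nat.Divisibility as ℕ∣
import Data.Nat.Properties as ℕ
open import Data.Product using (Σ; ∃; _×_; _,_; proj₁; proj₂)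
open import Data.Rational as ℚ using (ℚ; 0ℚ)
open import Data.Sum using (_⊎_; inj₁; inj₂)
open import Function using (_⇔_)
open import Function.Definitions using (Surjective)
open import Relation.Binary.PropositionalEquality
  using (_≡_; refl; sym; trans; cong; cong₂; subst; subst₂)
open import Relation.Nullary using (¬_)
open import Relation.Nullary.Decidable using (from-no)

3^≢0 : ∀ n → ℕ.NonZero (3 ℕ.^ n)
3^≢0 n = ℕ.m^n≢0 3 n

------------------------------------------------------------------------
-- Congruences in ℤ

infix 4 _≡_[modℤ_]
record _≡_[modℤ_] (a b d : ℤ) : Set where
  constructor congruent
  field
    ∣-difference : d ℤ∣.∣ a ℤ.- b

open _≡_[modℤ_] public

module Congℤ {d : ℤ} where

  infix 4 _~_
  _~_ : ℤ → ℤ → Set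
  a ~ b = a ≡ b [modℤ d ]

  abstract
    ~-reflexive : ∀ {a b} → a ≡ b → a ~ b
    ~-reflexive {a} refl = congruent (divides (+ 0) (ℤ.i≡j⇒i-j≡0 {a} refl))

    ~-refl : ∀ {a} → a ~ a
    ~-refl = ~-reflexive refl

    ~-sym : ∀ {a b} → a ~ b → b ~ a
    ~-sym {a} {b} (congruent p) = congruent (subst (d ℤ∣.∣_) (lem a b) (ℤ∣.∣m⇒∣-m p))
      where
      lem : ∀ a b → ℤ.- (a ℤ.- b) ≡ b ℤ.- a
      lem = solve-∀

    ~-trans : ∀ {a b c} → a ~ b → b ~ c → a ~ c
    ~-trans {a} {b} {c} (congruent p) (congruent q) =
      congruent (subst (d ℤ∣.∣_) (lem a b c) (ℤ∣.∣m∣n⇒∣m+n p q))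
      where
      lem : ∀ a b c → (a ℤ.- b) ℤ.+ (b ℤ.- c) ≡ a ℤ.- c
      lem = solve-∀

    ~-+ : ∀ {a b a′ b′} → a ~ b → a′ ~ b′ → a ℤ.+ a′ ~ b ℤ.+ b′
    ~-+ {a} {b} {a′} {b′} (congruent p) (congruent q) =
      congruent (subst (d ℤ∣.∣_) (lem a b a′ b′) (ℤ∣.∣m∣n⇒∣m+n p q))
      where
      lem : ∀ a b a′ b′ → (a ℤ.- b) ℤ.+ (a′ ℤ.- b′) ≡ (a ℤ.+ a′) ℤ.- (b ℤ.+ b′)
      lem = solve-∀

    ~-* : ∀ {a b a′ b′} → a ~ b → a′ ~ b′ → a ℤ.* a′ ~ b ℤ.* b′
    ~-* {a} {b} {a′} {b′} (congruent p) (congruent q) =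
      congruent (subst (d ℤ∣.∣_) (lem a b a′ b′)
        (ℤ∣.∣m∣n⇒∣m+n (ℤ∣.∣m⇒∣m*n a′ p) (ℤ∣.∣n⇒∣m*n b q)))
      where
      lem : ∀ a b a′ b′ →
        (a ℤ.- b) ℤ.* a′ ℤ.+ b ℤ.* (a′ ℤ.- b′) ≡ a ℤ.* a′ ℤ.- b ℤ.* b′
      lem = solve-∀

    ~-neg : ∀ {a b} → a ~ b → ℤ.- a ~ ℤ.- b
    ~-neg {a} {b} (congruent p) = congruent (subst (d ℤ∣.∣_) (lem a b) (ℤ∣.∣m⇒∣-m p))
      where
      lem : ∀ a b → ℤ.- (a ℤ.- b) ≡ (ℤ.- a) ℤ.- (ℤ.- b)
      lem = solve-∀

open Congℤ public

~-weaken : ∀ {d e a b} → d ℤ∣.∣ e → a ≡ b [modℤ e ] → a ≡ b [modℤ d ]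
~-weaken d∣e (congruent p) = congruent (ℤ∣.∣-trans d∣e p)

3^suc : ∀ n → + (3 ℕ.^ suc n) ≡ + 3 ℤ.* + (3 ℕ.^ n)
3^suc n = ℤ.pos-* 3 (3 ℕ.^ n)

3^-+ : ∀ m n → + (3 ℕ.^ (m ℕ.+ n)) ≡ + (3 ℕ.^ m) ℤ.* + (3 ℕ.^ n)
3^-+ m n = trans (cong +_ (ℕ.^-distribˡ-+-* 3 m n)) (ℤ.pos-* (3 ℕ.^ m) (3 ℕ.^ n))

3^-≤ : ∀ {m n} → m ℕ.≤ n → + (3 ℕ.^ m) ℤ∣.∣ + (3 ℕ.^ n)
3^-≤ {m} {n} m≤n = divides (+ (3 ℕ.^ (n ℕ.∸ m)))
  (trans (cong (λ k → + (3 ℕ.^ k)) (sym (ℕ.m∸n+n≡m m≤n))) (3^-+ (n ℕ.∸ m) m))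

1∣ : ∀ a → + 1 ℤ∣.∣ a
1∣ a = divides a (sym (ℤ.*-identityʳ a))

------------------------------------------------------------------------
-- The ring ℤ₃, as the inverse limit of the rings ℤ/3ⁿ: approx x n
-- represents the residue of x modulo 3ⁿ, and the choice of
-- representatives is forgotten by _≈_.

record ℤ₃ : Set where
  no-eta-equality
  constructor mkℤ₃
  field
    approx   : ℕ → ℤ
    coherent : ∀ n → approx (suc n) ≡ approx n [modℤ + (3 ℕ.^ n) ]

open ℤ₃ public

infix 4 _≈_

record _≈_ (x y : ℤ₃) : Set where
  constructor mk≈
  field
    at : ∀ n → approx x n ≡ approx y n [modℤ + (3 ℕ.^ n) ]

open _≈_ public

fromℤ : ℤ → ℤ₃
fromℤ a .approx   n = a
fromℤ a .coherent n = ~-refl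

infixl 6 _+_ _-_
infixl 7 _*_
infix  8 -_

_+_ : ℤ₃ → ℤ₃ → ℤ₃
(x + y) .approx   n = approx x n ℤ.+ approx y n
(x + y) .coherent n = ~-+ (coherent x n) (coherent y n)

_*_ : ℤ₃ → ℤ₃ → ℤ₃
(x * y) .approx   n = approx x n ℤ.* approx y n
(x * y) .coherent n = ~-* (coherent x n) (coherent y n)

-_ : ℤ₃ → ℤ₃
(- x) .approx   n = ℤ.- approx x n
(- x) .coherent n = ~-neg (coherent x n)

_-_ : ℤ₃ → ℤ₃ → ℤ₃
x - y = x + (- y)

0# 1# : ℤ₃
0# = fromℤ (+ 0)
1# = fromℤ (+ 1)

private
  pointwise : ∀ {x y} → (∀ n → approx x n ≡ approx y n) → x ≈ y
  pointwise eq = mk≈ λ n → ~-reflexive (eq n)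

  ≈-refl : ∀ {x} → x ≈ x
  ≈-refl = mk≈ λ _ → ~-refl

  ≈-sym : ∀ {x y} → x ≈ y → y ≈ x
  ≈-sym p = mk≈ λ n → ~-sym (at p n)

  ≈-trans : ∀ {x y z} → x ≈ y → y ≈ z → x ≈ z
  ≈-trans p q = mk≈ λ n → ~-trans (at p n) (at q n)

ℤ₃-commutativeRing : CommutativeRing _ _
ℤ₃-commutativeRing = record
  { Carrier = ℤ₃ ; _≈_ = _≈_ ; _+_ = _+_ ; _*_ = _*_ ; -_ = -_ ; 0# = 0# ; 1# = 1#
  ; isCommutativeRing = record
    { isRing = record
      { +-isAbelianGroup = record
        { isGroup = record
          { isMonoid = record
            { isSemigroup = record
              { isMagma = record
                { isEquivalence = record
                  { refl = ≈-refl ; sym = ≈-sym ; trans = ≈-trans }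
                ; ∙-cong = λ p q → mk≈ λ n → ~-+ (at p n) (at q n)
                }
              ; assoc = λ x y z → pointwise λ n →
                  ℤ.+-assoc (approx x n) (approx y n) (approx z n)
              }
            ; identity = (λ x → pointwise λ n → ℤ.+-identityˡ (approx x n))
                       , (λ x → pointwise λ n → ℤ.+-identityʳ (approx x n))
            }
          ; inverse = (λ x → pointwise λ n → ℤ.+-inverseˡ (approx x n))
                    , (λ x → pointwise λ n → ℤ.+-inverseʳ (approx x n))
          ; ⁻¹-cong = λ p → mk≈ λ n → ~-neg (at p n)
          }
        ; comm = λ x y → pointwise λ n → ℤ.+-comm (approx x n) (approx y n)
        }
      ; *-cong = λ p q → mk≈ λ n → ~-* (at p n) (at q n)
      ; *-assoc = λ x y z → pointwise λ n →
          ℤ.*-assoc (approx x n) (approx y n) (approx z n)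
      ; *-identity = (λ x → pointwise λ n → ℤ.*-identityˡ (approx x n))
                   , (λ x → pointwise λ n → ℤ.*-identityʳ (approx x n))
      ; distrib = (λ x y z → pointwise λ n →
                     ℤ.*-distribˡ-+ (approx x n) (approx y n) (approx z n))
                , (λ x y z → pointwise λ n →
                     ℤ.*-distribʳ-+ (approx x n) (approx y n) (approx z n))
      }
    ; *-comm = λ x y → pointwise λ n → ℤ.*-comm (approx x n) (approx y n)
    }
  }

ℤ₃-rawSemiring : RawSemiring _ _
ℤ₃-rawSemiring = Semiring.rawSemiring (CommutativeRing.semiring ℤ₃-commutativeRing)

open RawSemiringDefs ℤ₃-rawSemiring public using (_∣_; _^_)

3^[_] : ℕ → ℤ₃
3^[ n ] = fromℤ (+ (3 ℕ.^ n))

infix 4 _≡_[mod3^_]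
_≡_[mod3^_] : ℤ₃ → ℤ₃ → ℕ → Set
x ≡ y [mod3^ n ] = 3^[ n ] ∣ (x - y)

approx-from : ∀ x n k → approx x (k ℕ.+ n) ≡ approx x n [modℤ + (3 ℕ.^ n) ]
approx-from x n zero    = ~-refl
approx-from x n (suc k) =
  ~-trans (~-weaken (3^-≤ (ℕ.m≤n+m n k)) (coherent x (k ℕ.+ n))) (approx-from x n k)

-- Divisibility by 3ⁿ in the ring ℤ₃ is detected modulo 3ⁿ.

∣⇒approx : ∀ n {x} → 3^[ n ] ∣ x → + (3 ℕ.^ n) ℤ∣.∣ approx x n
∣⇒approx n {x} (t , t*3ⁿ≈x) =
  subst (+ (3 ℕ.^ n) ℤ∣.∣_) (lem (approx t n) (+ (3 ℕ.^ n)) (approx x n))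
    (ℤ∣.∣m∣n⇒∣m-n (ℤ∣.∣n⇒∣m*n (approx t n) ℤ∣.∣-refl)
      (∣-difference (at t*3ⁿ≈x n)))
  where
  lem : ∀ t d x → t ℤ.* d ℤ.- (t ℤ.* d ℤ.- x) ≡ x
  lem = solve-∀

approx⇒∣ : ∀ n {x} → + (3 ℕ.^ n) ℤ∣.∣ approx x n → 3^[ n ] ∣ x
approx⇒∣ n {x} 3ⁿ∣xₙ = mkℤ₃ t t-coherent , mk≈ λ k →
    subst (_≡ approx x k [modℤ + (3 ℕ.^ k) ]) (t-eq k)
      (subst (λ m → approx x m ≡ approx x k [modℤ + (3 ℕ.^ k) ]) (ℕ.+-comm n k)
        (approx-from x k n))
  where
  D : ℤ
  D = + (3 ℕ.^ n)

  3ⁿ∣ : ∀ k → D ℤ∣.∣ approx x (k ℕ.+ n)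
  3ⁿ∣ k = subst (D ℤ∣.∣_) (lem (approx x (k ℕ.+ n)) (approx x n))
    (ℤ∣.∣m∣n⇒∣m+n (∣-difference (approx-from x n k)) 3ⁿ∣xₙ)
    where
    lem : ∀ a b → (a ℤ.- b) ℤ.+ b ≡ a
    lem = solve-∀

  t : ℕ → ℤ
  t k = ℤ∣.quotient (3ⁿ∣ k)

  t-eq : ∀ k → approx x (k ℕ.+ n) ≡ t k ℤ.* D
  t-eq k = ℤ∣._∣_.equality (3ⁿ∣ k)

  t-coherent : ∀ k → t (suc k) ≡ t k [modℤ + (3 ℕ.^ k) ]
  t-coherent k = congruent (ℤ∣.*-cancelʳ-∣ D {{3^≢0 n}}
    (subst₂ ℤ∣._∣_ (3^-+ k n)
      (trans (cong₂ ℤ._-_ (t-eq (suc k)) (t-eq k)) (lem (t (suc k)) (t k) D))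
      (∣-difference (coherent x (k ℕ.+ n)))))
    where
    lem : ∀ a b d → a ℤ.* d ℤ.- b ℤ.* d ≡ (a ℤ.- b) ℤ.* d
    lem = solve-∀

mod3^⇒approx : ∀ n {x y} → x ≡ y [mod3^ n ] →
  approx x n ≡ approx y n [modℤ + (3 ℕ.^ n) ]
mod3^⇒approx n x≡y = congruent (∣⇒approx n x≡y)

approx⇒mod3^ : ∀ n {x y} → approx x n ≡ approx y n [modℤ + (3 ℕ.^ n) ] →
  x ≡ y [mod3^ n ]
approx⇒mod3^ n xₙ≡yₙ = approx⇒∣ n (∣-difference xₙ≡yₙ)

------------------------------------------------------------------------
-- The 3-adic metric

3^-[_] : ℕ → ℚ
3^-[ n ] = (+ 1 ℚ./ (3 ℕ.^ n)) {{3^≢0 n}}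

-- Norm x r says |x| = r.  The norm takes only the values 0 and 3⁻ⁿ, but it
-- is given by its graph, because x ≈ 0# is not decidable.
Norm : ℤ₃ → ℚ → Set
Norm x r =
    (x ≈ 0# × r ≡ 0ℚ)
  ⊎ (∃ λ n → 3^[ n ] ∣ x × ¬ (3^[ suc n ] ∣ x) × r ≡ 3^-[ n ])

Distance : ℤ₃ → ℤ₃ → ℚ → Set
Distance x y r = Norm (x - y) r

record IsIsometry (f : ℤ₃ → ℤ₃) : Set where
  field
    preserves-distance : ∀ x y r → Distance x y r ⇔ Distance (f x) (f y) r
    surjective         : Surjective _≈_ _≈_ f

Continuous : (ℤ₃ → ℤ₃) → Set
Continuous f = ∀ x n → ∃ λ m → ∀ y → x ≡ y [mod3^ m ] → f x ≡ f y [mod3^ n ]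

------------------------------------------------------------------------
-- The functions ι_q

infix 4 _∈U^_
_∈U^_ : ℤ₃ → ℕ → Set
q ∈U^ m = q ≡ 1# [mod3^ m ]

module GeometricSum {c ℓ} (R : RawSemiring c ℓ) where
  private
    module R = RawSemiring R
  open RawSemiringDefs R using () renaming (_^_ to _^ᴿ_)

  -- geometric q n = 1 + q + ⋯ + qⁿ⁻¹
  geometric : R.Carrier → ℕ → R.Carrier
  geometric q zero    = R.0#
  geometric q (suc n) = geometric q n R.+ q ^ᴿ n

open GeometricSum ℤ₃-rawSemiring public using (geometric)

-- f is continuous with f(n) = 1 + q + ⋯ + qⁿ⁻¹ for all n ≥ 0.
record IsInterpolation (q : ℤ₃) (f : ℤ₃ → ℤ₃) : Set where
  field
    continuous : Continuous f
    values     : ∀ n → f (fromℤ (+ n)) ≈ geometric q n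

private
  open RawSemiringDefs ℤ.+-*-rawSemiring using () renaming (_^_ to _^ℤ_)
  open GeometricSum ℤ.+-*-rawSemiring using () renaming (geometric to geoℤ)

  approx-^ : ∀ q k n → approx (q ^ k) n ≡ approx q n ^ℤ k
  approx-^ q zero    n = refl
  approx-^ q (suc k) n = cong (approx q n ℤ.*_) (approx-^ q k n)

  approx-geometric : ∀ q k n → approx (geometric q k) n ≡ geoℤ (approx q n) k
  approx-geometric q zero    n = refl
  approx-geometric q (suc k) n = cong₂ ℤ._+_ (approx-geometric q k n) (approx-^ q k n)

  ^ℤ-+ : ∀ a m n → a ^ℤ (m ℕ.+ n) ≡ a ^ℤ m ℤ.* a ^ℤ n
  ^ℤ-+ a zero    n = sym (ℤ.*-identityˡ _)
  ^ℤ-+ a (suc m) n = trans (cong (a ℤ.*_) (^ℤ-+ a m n)) (sym (ℤ.*-assoc a _ _))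

  ^ℤ-~1 : ∀ {d a} → a ≡ + 1 [modℤ d ] → ∀ m → a ^ℤ m ≡ + 1 [modℤ d ]
  ^ℤ-~1 p zero    = ~-refl
  ^ℤ-~1 p (suc m) = ~-* p (^ℤ-~1 p m)

  geoℤ-+ : ∀ a m n → geoℤ a (m ℕ.+ n) ≡ geoℤ a m ℤ.+ a ^ℤ m ℤ.* geoℤ a n
  geoℤ-+ a m zero = trans (cong (geoℤ a) (ℕ.+-identityʳ m)) (lem (geoℤ a m) (a ^ℤ m))
    where
    lem : ∀ g x → g ≡ g ℤ.+ x ℤ.* + 0
    lem = solve-∀
  geoℤ-+ a m (suc n) = trans (cong (geoℤ a) (ℕ.+-suc m n))
    (trans (cong₂ ℤ._+_ (geoℤ-+ a m n) (^ℤ-+ a m n))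
           (lem (geoℤ a m) (a ^ℤ m) (geoℤ a n) (a ^ℤ n)))
    where
    lem : ∀ g x h y → (g ℤ.+ x ℤ.* h) ℤ.+ x ℤ.* y ≡ g ℤ.+ x ℤ.* (h ℤ.+ y)
    lem = solve-∀

  geoℤ-3^ : ∀ {a} → a ≡ + 1 [modℤ + 3 ] → ∀ n → + (3 ℕ.^ n) ℤ∣.∣ geoℤ a (3 ℕ.^ n)
  geoℤ-3^ p zero = 1∣ _
  geoℤ-3^ {a} p (suc n) =
    subst₂ ℤ∣._∣_ (sym (3^suc n)) (sym geo-3m)
      (ℤ∣.∣-trans (ℤ∣.*-monoˡ-∣ (+ (3 ℕ.^ n)) 3∣factor)
                  (ℤ∣.*-monoʳ-∣ (+ 1 ℤ.+ x ℤ.+ x ℤ.* x) (geoℤ-3^ p n)))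
    where
    m : ℕ
    m = 3 ℕ.^ n
    x : ℤ
    x = a ^ℤ m

    lem : ∀ g x →
      g ℤ.+ x ℤ.* (g ℤ.+ x ℤ.* (g ℤ.+ x ℤ.* + 0)) ≡ (+ 1 ℤ.+ x ℤ.+ x ℤ.* x) ℤ.* g
    lem = solve-∀

    geo-3m : geoℤ a (3 ℕ.* m) ≡ (+ 1 ℤ.+ x ℤ.+ x ℤ.* x) ℤ.* geoℤ a m
    geo-3m =
      trans (geoℤ-+ a m _)
      (trans (cong (λ h → geoℤ a m ℤ.+ x ℤ.* h) (geoℤ-+ a m _))
      (trans (cong (λ h → geoℤ a m ℤ.+ x ℤ.* (geoℤ a m ℤ.+ x ℤ.* h)) (geoℤ-+ a m 0))
             (lem (geoℤ a m) x)))

    factor-eq : ∀ x → (x ℤ.- + 1) ℤ.* (x ℤ.+ + 2) ℤ.+ + 1 ℤ.* + 3 ≡ + 1 ℤ.+ x ℤ.+ x ℤ.* x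
    factor-eq = solve-∀

    3∣factor : + 3 ℤ∣.∣ + 1 ℤ.+ x ℤ.+ x ℤ.* x
    3∣factor = subst (+ 3 ℤ∣.∣_) (factor-eq x)
      (ℤ∣.∣m∣n⇒∣m+n (ℤ∣.∣m⇒∣m*n (x ℤ.+ + 2) (∣-difference (^ℤ-~1 p m))) (divides (+ 1) refl))

  geoℤ-3^* : ∀ {a} → a ≡ + 1 [modℤ + 3 ] → ∀ n k →
    + (3 ℕ.^ n) ℤ∣.∣ geoℤ a (k ℕ.* 3 ℕ.^ n)
  geoℤ-3^* p n zero = divides (+ 0) refl
  geoℤ-3^* {a} p n (suc k) = subst (+ (3 ℕ.^ n) ℤ∣.∣_) (sym (geoℤ-+ a (3 ℕ.^ n) _))
    (ℤ∣.∣m∣n⇒∣m+n (geoℤ-3^ p n) (ℤ∣.∣n⇒∣m*n (a ^ℤ (3 ℕ.^ n)) (geoℤ-3^* p n k)))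

  geoℤ-≤ : ∀ {a} → a ≡ + 1 [modℤ + 3 ] → ∀ n {k l} → k ℕ.≤ l →
    + l ≡ + k [modℤ + (3 ℕ.^ n) ] → geoℤ a l ≡ geoℤ a k [modℤ + (3 ℕ.^ n) ]
  geoℤ-≤ {a} p n {k} {l} k≤l l~k
    with ℤ∣.∣⇒∣ᵤ (subst (+ (3 ℕ.^ n) ℤ∣.∣_) (trans (ℤ.m-n≡m⊖n l k) (ℤ.⊖-≥ k≤l)) (∣-difference l~k))
  ... | ℕ∣.divides c eq =
    congruent (subst (+ (3 ℕ.^ n) ℤ∣.∣_) (sym difference)
      (ℤ∣.∣n⇒∣m*n (a ^ℤ k) (geoℤ-3^* p n c)))
    where
    lem : ∀ g h → (g ℤ.+ h) ℤ.- g ≡ h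
    lem = solve-∀

    difference : geoℤ a l ℤ.- geoℤ a k ≡ a ^ℤ k ℤ.* geoℤ a (c ℕ.* 3 ℕ.^ n)
    difference =
      trans (cong (λ m → geoℤ a m ℤ.- geoℤ a k)
              (trans (sym (ℕ.m+[n∸m]≡n k≤l)) (cong (k ℕ.+_) eq)))
      (trans (cong (ℤ._- geoℤ a k) (geoℤ-+ a k (c ℕ.* 3 ℕ.^ n)))
             (lem (geoℤ a k) _))

  geoℤ-cong : ∀ {a} → a ≡ + 1 [modℤ + 3 ] → ∀ n k l →
    + k ≡ + l [modℤ + (3 ℕ.^ n) ] → geoℤ a k ≡ geoℤ a l [modℤ + (3 ℕ.^ n) ]
  geoℤ-cong p n k l k~l with ℕ.≤-total k l
  ... | inj₁ k≤l = ~-sym (geoℤ-≤ p n k≤l (~-sym k~l))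
  ... | inj₂ l≤k = geoℤ-≤ p n l≤k k~l

  approx-U¹ : ∀ {q} → q ∈U^ 1 → ∀ n → approx q (suc n) ≡ + 1 [modℤ + 3 ]
  approx-U¹ {q} (t , t*3≈q-1) n =
    congruent (subst (+ 3 ℤ∣.∣_) (lem (approx t (suc n)) (approx q (suc n)))
      (ℤ∣.∣m∣n⇒∣m-n (ℤ∣.∣n⇒∣m*n (approx t (suc n)) (ℤ∣.∣-refl {+ 3}))
        (ℤ∣.∣-trans (3^-≤ {1} {suc n} (ℕ.s≤s ℕ.z≤n))
          (∣-difference (at t*3≈q-1 (suc n))))))
    where
    lem : ∀ t q → t ℤ.* + 3 ℤ.- (t ℤ.* + 3 ℤ.- (q ℤ.- + 1)) ≡ q ℤ.- + 1
    lem = solve-∀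

geometric-cong : ∀ {q} → q ∈U^ 1 → ∀ n k l → + k ≡ + l [modℤ + (3 ℕ.^ n) ] →
  approx (geometric q k) n ≡ approx (geometric q l) n [modℤ + (3 ℕ.^ n) ]
geometric-cong q∈U zero k l k~l = congruent (1∣ _)
geometric-cong {q} q∈U (suc n) k l k~l =
  subst₂ (λ g h → g ≡ h [modℤ + (3 ℕ.^ suc n) ])
    (sym (approx-geometric q k (suc n))) (sym (approx-geometric q l (suc n)))
    (geoℤ-cong (approx-U¹ q∈U n) (suc n) k l k~l)

residue : ℤ₃ → ℕ → ℕ
residue z n = (approx z n ℤ.%ℕ (3 ℕ.^ n)) {{3^≢0 n}}

residue-≡ : ∀ z n → + residue z n ≡ approx z n [modℤ + (3 ℕ.^ n) ]
residue-≡ z n = ~-sym (congruent (divides c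
    (trans (cong (ℤ._- + residue z n) (ℤ.a≡a%ℕn+[a/ℕn]*n (approx z n) (3 ℕ.^ n) {{3^≢0 n}}))
           (lem (+ residue z n) (c ℤ.* + (3 ℕ.^ n))))))
  where
  c : ℤ
  c = (approx z n ℤ./ℕ (3 ℕ.^ n)) {{3^≢0 n}}

  lem : ∀ r x → (r ℤ.+ x) ℤ.- r ≡ x
  lem = solve-∀

-- For q ∈ U⁽¹⁾ the sum 1 + q + ⋯ + qᵏ⁻¹ modulo 3ⁿ depends only on k modulo 3ⁿ,
-- so ι_q(z) modulo 3ⁿ is this sum for k the residue of z modulo 3ⁿ.  The lemmas
-- ι-interpolates and interpolation-unique show that this is the ι_q wanted.

ι : (q : ℤ₃) → q ∈U^ 1 → ℤ₃ → ℤ₃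
ι q q∈U z .approx   n = approx (geometric q (residue z n)) n
ι q q∈U z .coherent n =
  ~-trans (coherent (geometric q (residue z (suc n))) n)
    (geometric-cong q∈U n (residue z (suc n)) (residue z n)
      (~-trans (~-weaken (3^-≤ (ℕ.n≤1+n n)) (residue-≡ z (suc n)))
        (~-trans (coherent z n) (~-sym (residue-≡ z n)))))

ι-interpolates : ∀ q (q∈U : q ∈U^ 1) → IsInterpolation q (ι q q∈U)
ι-interpolates q q∈U = record
  { continuous = λ x n → n , λ y x≡y → approx⇒mod3^ n
      (geometric-cong q∈U n (residue x n) (residue y n)
        (~-trans (residue-≡ x n)
          (~-trans (mod3^⇒approx n x≡y) (~-sym (residue-≡ y n)))))
  ; values = λ k → mk≈ λ n →
      geometric-cong q∈U n (residue (fromℤ (+ k)) n) k (residue-≡ (fromℤ (+ k)) n)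
  }

interpolation-unique : ∀ q {f g} → IsInterpolation q f → IsInterpolation q g →
  ∀ z → f z ≈ g z
interpolation-unique q {f} {g} F G z = mk≈ λ n →
  let
    (i , f-cont) = F.continuous z n
    (j , g-cont) = G.continuous z n
    m = i ℕ.+ j
    k = residue z m
    near : ∀ {l} → l ℕ.≤ m → z ≡ fromℤ (+ k) [mod3^ l ]
    near {l} l≤m = approx⇒mod3^ l
      (~-sym (~-trans (~-weaken (3^-≤ l≤m) (residue-≡ z m))
        (subst (λ o → approx z o ≡ approx z l [modℤ + (3 ℕ.^ l) ])
          (ℕ.m∸n+n≡m l≤m) (approx-from z l (m ℕ.∸ l)))))
  in
  ~-trans (mod3^⇒approx n (f-cont (fromℤ (+ k)) (near (ℕ.m≤m+n i j))))
  (~-trans (~-trans (at (F.values k) n) (~-sym (at (G.values k) n)))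
           (~-sym (mod3^⇒approx n (g-cont (fromℤ (+ k)) (near (ℕ.m≤n+m j i))))))
  where
  module F = IsInterpolation F
  module G = IsInterpolation G

------------------------------------------------------------------------
-- The fixed-point map

record U¹-U² : Set where
  constructor mkU
  field
    elt  : ℤ₃
    in-1 : elt ∈U^ 1
    ∉-2  : ¬ (elt ∈U^ 2)

open U¹-U² public

record IsNontrivialFixedPoint (q : U¹-U²) (z : ℤ₃) : Set where
  field
    fixed : ι (elt q) (in-1 q) z ≈ z
    ≉0    : ¬ (z ≈ 0#)
    ≉1    : ¬ (z ≈ 1#)

-- q₀ and q₁ are by definition the exceptional q with q ≡ 7 and q ≡ 4 modulo 9
-- respectively.  They are not assumed to exist or to be unique, nor are the
-- nontrivial fixed points of the other q: the clauses of IsFixedPointMap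
-- determine Φ up to _≈_ in any case.
IsExceptional : U¹-U² → Set
IsExceptional q = ∀ z → ¬ IsNontrivialFixedPoint q z

record IsFixedPointMap (Φ : U¹-U² → ℤ₃) : Set where
  field
    generic : ∀ q z → IsNontrivialFixedPoint q z → Φ q ≈ z
    at-q₀   : ∀ q → elt q ≡ fromℤ (+ 7) [mod3^ 2 ] → IsExceptional q → Φ q ≈ 0#
    at-q₁   : ∀ q → elt q ≡ fromℤ (+ 4) [mod3^ 2 ] → IsExceptional q → Φ q ≈ 1#

private
  shift-∈U¹ : ∀ a b x → + 3 ℤ∣.∣ a ℤ.- + 1 → + 3 ℤ∣.∣ b →
    (fromℤ a + fromℤ b * x) ∈U^ 1
  shift-∈U¹ a b x p q = approx⇒∣ 1 (subst (+ 3 ℤ∣.∣_) (lem a b (approx x 1))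
      (ℤ∣.∣m∣n⇒∣m+n p (ℤ∣.∣m⇒∣m*n (approx x 1) q)))
    where
    lem : ∀ a b x → (a ℤ.- + 1) ℤ.+ b ℤ.* x ≡ (a ℤ.+ b ℤ.* x) ℤ.- + 1
    lem = solve-∀

  shift-∉U² : ∀ a x → ¬ (+ 9 ℤ∣.∣ a ℤ.- + 1) → ¬ ((fromℤ a + fromℤ (+ 9) * x) ∈U^ 2)
  shift-∉U² a x ¬p q = ¬p (subst (+ 9 ℤ∣.∣_) (lem a (approx x 2))
      (ℤ∣.∣m∣n⇒∣m-n (∣⇒approx 2 q) (ℤ∣.∣m⇒∣m*n (approx x 2) (ℤ∣.∣-refl {+ 9}))))
    where
    lem : ∀ a x → ((a ℤ.+ + 9 ℤ.* x) ℤ.- + 1) ℤ.- + 9 ℤ.* x ≡ a ℤ.- + 1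
    lem = solve-∀

4+9* 7+9* : ℤ₃ → U¹-U²
4+9* x = mkU (fromℤ (+ 4) + fromℤ (+ 9) * x)
  (shift-∈U¹ (+ 4) (+ 9) x (divides (+ 1) refl) (divides (+ 3) refl))
  (shift-∉U² (+ 4) x (from-no (+ 9 ℤ∣.∣? + 3)))
7+9* x = mkU (fromℤ (+ 7) + fromℤ (+ 9) * x)
  (shift-∈U¹ (+ 7) (+ 9) x (divides (+ 2) refl) (divides (+ 3) refl))
  (shift-∉U² (+ 7) x (from-no (+ 9 ℤ∣.∣? + 6)))

-- y = t / 3, where t ∈ 3 ℤ₃; such a y is unique.
_IsThirdOf_ : ℤ₃ → ℤ₃ → Set
y IsThirdOf t = fromℤ (+ 3) * y ≈ t

{-# OPTIONS --safe #-}
-- Write q = 1 + 3u.  Expanding ι_q in falling factorials gives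
--   2 (ι_q(z) - z) = 3 u z (z - 1) h(u, z),
--   h(u, z) = Σ_j (2 · 3ʲ / (j + 2)!) uʲ (z - 2)(z - 3)⋯(z - j - 1)
--           = 1 + (z - 2) u + 3 R(u, z),
-- where R has 3-adically integral coefficients tending to 0 by Legendre's
-- formula.  Since u is a unit, the nontrivial fixed points are the zeros of
-- h(u, -) other than 0 and 1.  For u = 1 + 3x, z = 1 + 3y, and for u = 2 + 3x,
-- z = 3y, the equation h(u, z) = 0 becomes y = x + M(x, y), where M multiplies
-- distances by at most 1/3.  Hence x and y determine each other, isometrically.
-- Whether z is 0 or 1 is undecidable, but _≈_ is stable under double negation,
-- so the clauses defining Φ still identify Φ(q) with the zero of h(u, -).

module Submission where

open import Algebra.Bundles using (CommutativeRing)
open import Algebra.Definitions.RawMagma using (_,_)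
open import Data.Integer as ℤ using (ℤ; +_)
open import Data.Integer.Divisibility.Signed as ℤ∣ using (divides)
import Data.Integer.DivMod as ℤ
import Data.Integer.Properties as ℤ
open import Data.Integer.Tactic.RingSolver using (solve-∀)
open import Data.Nat as ℕ using (ℕ; zero; suc)
import Data.Nat.DivMod as ℕ
open import Data.Nat.Induction using (<-rec)
import Data.Nat.Properties as ℕ
import Data.Nat.Tactic.RingSolver as ℕ-Solver
open import Data.Product using (∃; ∃₂; _×_; _,_; proj₁; proj₂)
open import Data.Sum using (_⊎_; inj₁; inj₂)
open import Defs
open import Function using (_⇔_; mk⇔; Equivalence; _∘_)
open import Function.Definitions using (Surjective)
open import Function.Properties.Equivalence using () renaming (sym to ⇔-sym)
open import Relation.Binary.Bundles using (Setoid)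
open import Relation.Binary.PropositionalEquality
  using (_≡_; refl; sym; trans; cong; subst; subst₂)
import Relation.Binary.Reasoning.Setoid as ≈-Reasoning
open import Relation.Nullary using (¬_; Dec; yes; no; contradiction)
open import Relation.Nullary.Decidable
  using (map′; decidable-stable; from-no; ¬¬-excluded-middle)

open import Algebra.Properties.CommutativeSemigroup
  (CommutativeRing.*-commutativeSemigroup ℤ₃-commutativeRing) using (x∙yz≈y∙xz)

private
  module R = CommutativeRing ℤ₃-commutativeRing

-- Equality in the 3-adic integers as congruence modulo every power of 3

≗⇒≈ : ∀ {x y} → (∀ n → approx x n ≡ approx y n) → x ≈ y
≗⇒≈ eq = mk≈ λ n → ~-reflexive (eq n)

-- Congruence modulo 3ⁿ, compared at level n only; unlike _≡_[mod3^_] it is a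
-- record type, so that Agda can infer x, y and n from it.
infix 4 _≈_[mod3^_]
record _≈_[mod3^_] (x y : ℤ₃) (n : ℕ) : Set where
  constructor at-level
  field
    level : approx x n ≡ approx y n [modℤ + (3 ℕ.^ n) ]

open _≈_[mod3^_]

≈⇒mod : ∀ {x y n} → x ≈ y → x ≈ y [mod3^ n ]
≈⇒mod {n = n} p = at-level (at p n)

mod⇒≈ : ∀ {x y} → (∀ n → x ≈ y [mod3^ n ]) → x ≈ y
mod⇒≈ p = mk≈ (level ∘ p)

mod? : ∀ {x y n} → Dec (x ≈ y [mod3^ n ])
mod? {x} {y} {n} = map′ (at-level ∘ congruent) (∣-difference ∘ level)
  (+ (3 ℕ.^ n) ℤ∣.∣? (approx x n ℤ.- approx y n))

-- Each single congruence is decidable, hence stable, and `_≈_` is their conjunction over all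
-- levels. This licenses classical case distinctions in proofs of equalities.
≈-stable : ∀ {x y} → ¬ ¬ (x ≈ y) → x ≈ y
≈-stable ¬¬x≈y = mod⇒≈ λ n →
  decidable-stable mod? (λ ¬p → ¬¬x≈y (λ x≈y → ¬p (≈⇒mod x≈y)))

mod-refl : ∀ {x n} → x ≈ x [mod3^ n ]
mod-refl = at-level ~-refl

mod-sym : ∀ {x y n} → x ≈ y [mod3^ n ] → y ≈ x [mod3^ n ]
mod-sym (at-level p) = at-level (~-sym p)

mod-trans : ∀ {x y z n} → x ≈ y [mod3^ n ] → y ≈ z [mod3^ n ] → x ≈ z [mod3^ n ]
mod-trans (at-level p) (at-level q) = at-level (~-trans p q)

mod-setoid : ℕ → Setoid _ _
mod-setoid n = record
  { Carrier = ℤ₃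
  ; _≈_ = _≈_[mod3^ n ]
  ; isEquivalence = record { refl = mod-refl ; sym = mod-sym ; trans = mod-trans }
  }

mod-+ : ∀ {x y x′ y′ n} → x ≈ y [mod3^ n ] → x′ ≈ y′ [mod3^ n ] →
  x + x′ ≈ y + y′ [mod3^ n ]
mod-+ (at-level p) (at-level q) = at-level (~-+ p q)

mod-* : ∀ {x y x′ y′ n} → x ≈ y [mod3^ n ] → x′ ≈ y′ [mod3^ n ] →
  x * x′ ≈ y * y′ [mod3^ n ]
mod-* (at-level p) (at-level q) = at-level (~-* p q)

mod-neg : ∀ {x y n} → x ≈ y [mod3^ n ] → - x ≈ - y [mod3^ n ]
mod-neg (at-level p) = at-level (~-neg p)

mod-^ : ∀ {x y n} → x ≈ y [mod3^ n ] → ∀ k → x ^ k ≈ y ^ k [mod3^ n ]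
mod-^ p zero    = mod-refl
mod-^ p (suc k) = mod-* p (mod-^ p k)

mod-pred : ∀ {x y n} → x ≈ y [mod3^ suc n ] → x ≈ y [mod3^ n ]
mod-pred {x} {y} {n} (at-level p) = at-level
  (~-trans (~-sym (coherent x n))
    (~-trans (~-weaken (3^-≤ (ℕ.n≤1+n n)) p) (coherent y n)))

mod-0 : ∀ {x y} → x ≈ y [mod3^ 0 ]
mod-0 = at-level (congruent (1∣ _))

-- Reduces x ≈ y to a polynomial identity, which can be checked in ℤ.
combination : ∀ {l r x y} c → l ≈ r → x - y ≈ c * (l - r) → x ≈ y
combination {l} {r} {x} {y} c l≈r x-y≈ = begin
  x                     ≈⟨ ≗⇒≈ (λ n → lem₁ (approx x n) (approx y n)) ⟩
  (x - y) + y           ≈⟨ R.+-congʳ x-y≈ ⟩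
  c * (l - r) + y       ≈⟨ R.+-congʳ (R.*-congˡ (R.+-congʳ l≈r)) ⟩
  c * (r - r) + y       ≈⟨ ≗⇒≈ (λ n → lem₂ (approx c n) (approx r n) (approx y n)) ⟩
  y                     ∎
  where
  open ≈-Reasoning R.setoid
  lem₁ : ∀ x y → x ≡ (x ℤ.- y) ℤ.+ y
  lem₁ = solve-∀
  lem₂ : ∀ c r y → c ℤ.* (r ℤ.- r) ℤ.+ y ≡ y
  lem₂ = solve-∀

-≈0⇒≈ : ∀ {x y} → x - y ≈ 0# → x ≈ y
-≈0⇒≈ {x} {y} x-y≈0 = combination 1# x-y≈0 (≗⇒≈ λ n → lem (approx x n) (approx y n))
  where
  lem : ∀ x y → x ℤ.- y ≡ + 1 ℤ.* (x ℤ.- y ℤ.- + 0)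
  lem = solve-∀

≈⇒-≈0 : ∀ {x y} → x ≈ y → x - y ≈ 0#
≈⇒-≈0 {y = y} x≈y = R.trans (R.+-congʳ x≈y) (R.-‿inverseʳ y)

transpose : ∀ {x y m} → y ≈ x + m → x ≈ y - m
transpose {x} {y} {m} p = combination (- 1#) p
  (≗⇒≈ λ n → lem (approx x n) (approx y n) (approx m n))
  where
  lem : ∀ x y m → x ℤ.- (y ℤ.- m) ≡ (ℤ.- + 1) ℤ.* (y ℤ.- (x ℤ.+ m))
  lem = solve-∀

transpose⁻ : ∀ {x y m} → x ≈ y - m → y ≈ x + m
transpose⁻ {x} {y} {m} p = combination (- 1#) p
  (≗⇒≈ λ n → lem (approx x n) (approx y n) (approx m n))
  where
  lem : ∀ x y m → y ℤ.- (x ℤ.+ m) ≡ (ℤ.- + 1) ℤ.* (x ℤ.- (y ℤ.- m))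
  lem = solve-∀

-- Powers of 3 and units

⟨_⟩ : ℕ → ℤ₃
⟨ n ⟩ = fromℤ (+ n)

⟨suc⟩ : ∀ n → ⟨ suc n ⟩ ≈ ⟨ n ⟩ + 1#
⟨suc⟩ n = ≗⇒≈ λ _ → trans (cong +_ (ℕ.+-comm 1 n)) (ℤ.pos-+ n 1)

-- Coherence replaces the representatives at level `suc n` by those at level `n`, and the factor 3
-- makes up for the lost level. Every contraction below gains its extra level here.
3*-mod : ∀ {x y n} → x ≈ y [mod3^ n ] → ⟨ 3 ⟩ * x ≈ ⟨ 3 ⟩ * y [mod3^ suc n ]
3*-mod {x} {y} {n} (at-level p) = at-level (congruent
  (subst₂ ℤ∣._∣_ (sym (3^suc n)) (lem (approx x (suc n)) (approx y (suc n)))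
    (ℤ∣.*-monoʳ-∣ (+ 3) (∣-difference
      (~-trans (coherent x n) (~-trans p (~-sym (coherent y n))))))))
  where
  lem : ∀ a b → + 3 ℤ.* (a ℤ.- b) ≡ + 3 ℤ.* a ℤ.- + 3 ℤ.* b
  lem = solve-∀

3*-cancel-mod : ∀ {x y n} → ⟨ 3 ⟩ * x ≈ ⟨ 3 ⟩ * y [mod3^ suc n ] → x ≈ y [mod3^ n ]
3*-cancel-mod {x} {y} {n} (at-level p) = at-level
  (~-trans (~-sym (coherent x n)) (~-trans
    (congruent (ℤ∣.*-cancelˡ-∣ (+ 3)
      (subst₂ ℤ∣._∣_ (3^suc n) (lem (approx x (suc n)) (approx y (suc n)))
        (∣-difference p))))
    (coherent y n)))
  where
  lem : ∀ a b → + 3 ℤ.* a ℤ.- + 3 ℤ.* b ≡ + 3 ℤ.* (a ℤ.- b)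
  lem = solve-∀

3*-cancel : ∀ {x y} → ⟨ 3 ⟩ * x ≈ ⟨ 3 ⟩ * y → x ≈ y
3*-cancel p = mod⇒≈ λ n → 3*-cancel-mod (≈⇒mod p)

3^[+] : ∀ m n → 3^[ m ℕ.+ n ] ≈ 3^[ m ] * 3^[ n ]
3^[+] m n = ≗⇒≈ λ _ → 3^-+ m n

3^*-cancel : ∀ k {x y} → 3^[ k ] * x ≈ 3^[ k ] * y → x ≈ y
3^*-cancel zero    p = R.trans (R.sym (R.*-identityˡ _)) (R.trans p (R.*-identityˡ _))
3^*-cancel (suc k) {x} {y} p = 3^*-cancel k (3*-cancel
  (R.trans (R.sym (split x)) (R.trans p (split y))))
  where
  split : ∀ x → 3^[ suc k ] * x ≈ ⟨ 3 ⟩ * (3^[ k ] * x)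
  split x = R.trans (R.*-congʳ (3^[+] 1 k)) (R.*-assoc _ _ _)

3^[]≈0 : ∀ {k n} → n ℕ.≤ k → 3^[ k ] ≈ 0# [mod3^ n ]
3^[]≈0 {k} {n} n≤k = at-level (congruent
  (subst (+ (3 ℕ.^ n) ℤ∣.∣_) (sym (ℤ.+-identityʳ (+ (3 ℕ.^ k)))) (3^-≤ n≤k)))

∣⇒multiple : ∀ {d x} → d ∣ x → ∃ λ y → d * y ≈ x
∣⇒multiple (y , y*d≈x) = y , R.trans (R.*-comm _ _) y*d≈x

third : ∀ {x} → x ≈ 0# [mod3^ 1 ] → ∃ λ y → ⟨ 3 ⟩ * y ≈ x
third {x} (at-level (congruent p)) =
  ∣⇒multiple (approx⇒∣ 1 (subst (+ 3 ℤ∣.∣_) (ℤ.+-identityʳ (approx x 1)) p))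

∣-mod : ∀ n {x y} → 3^[ n ] ∣ x - y → x ≈ y [mod3^ n ]
∣-mod n p = at-level (mod3^⇒approx n p)

mod-∣ : ∀ n {x y} → x ≈ y [mod3^ n ] → 3^[ n ] ∣ x - y
mod-∣ n (at-level p) = approx⇒mod3^ n p

-- Limits and the contraction principle

limit : (s : ℕ → ℤ₃) → (∀ n → s (suc n) ≈ s n [mod3^ n ]) → ℤ₃
limit s s-cauchy .approx   n = approx (s n) n
limit s s-cauchy .coherent n =
  ~-trans (coherent (s (suc n)) n) (level (s-cauchy n))

limit-mod : ∀ s s-cauchy n → limit s s-cauchy ≈ s n [mod3^ n ]
limit-mod s s-cauchy n = at-level ~-refl

-- Lipschitz continuity with constant 1/3, phrased by congruences.
Contractive : (ℤ₃ → ℤ₃) → Set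
Contractive f = ∀ {x y n} → x ≈ y [mod3^ n ] → f x ≈ f y [mod3^ suc n ]

module _ (f : ℤ₃ → ℤ₃) (f-contractive : Contractive f) where

  private
    iterate : ℕ → ℤ₃
    iterate zero    = 0#
    iterate (suc n) = f (iterate n)

    iterate-cauchy : ∀ n → iterate (suc n) ≈ iterate n [mod3^ n ]
    iterate-cauchy zero    = mod-0
    iterate-cauchy (suc n) = f-contractive (iterate-cauchy n)

  -- Banach iteration from 0. Any two elements agree modulo 3⁰ and each application of `f` gains one
  -- level, so the n-th iterate is already correct modulo 3ⁿ.
  fixpoint : ℤ₃
  fixpoint = limit iterate iterate-cauchy

  fixpoint-fixed : fixpoint ≈ f fixpoint
  fixpoint-fixed = mod⇒≈ λ n → mod-pred
    (mod-trans (limit-mod iterate iterate-cauchy (suc n))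
      (mod-sym (f-contractive (limit-mod iterate iterate-cauchy n))))

  fixpoint-unique : ∀ {x y} → x ≈ f x → y ≈ f y → x ≈ y
  fixpoint-unique {x} {y} x≈fx y≈fy = mod⇒≈ go
    where
    go : ∀ n → x ≈ y [mod3^ n ]
    go zero    = mod-0
    go (suc n) = mod-trans (≈⇒mod x≈fx)
      (mod-trans (f-contractive (go n)) (≈⇒mod (R.sym y≈fy)))

-- Units and cancellation

IsUnit : ℤ₃ → Set
IsUnit x = ∃ λ y → y * x ≈ 1#

-- As `1 - x²` is divisible by 3, the map `t ↦ 1 + (1 - x²) t` contracts. Its fixed point `t`
-- inverts `x²`, so `t * x` inverts `x`. Both nonzero residues modulo 3 have square 1, so one
-- argument serves for both.
square≈1⇒unit : ∀ {x} → x * x ≈ 1# [mod3^ 1 ] → IsUnit x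
square≈1⇒unit {x} xx≈1 = t * x , combination 1# t-fixed
    (≗⇒≈ λ n → lem (approx t n) (approx x n))
  where
  1-xx≈0 : 1# - x * x ≈ 0# [mod3^ 1 ]
  1-xx≈0 = mod-trans (mod-+ mod-refl (mod-neg xx≈1)) (≈⇒mod (R.-‿inverseʳ 1#))

  s = proj₁ (third 1-xx≈0)

  f : ℤ₃ → ℤ₃
  f t = 1# + (1# - x * x) * t

  f-contractive : Contractive f
  f-contractive p = mod-+ mod-refl
    (mod-trans (mod-* (≈⇒mod (R.sym (proj₂ (third 1-xx≈0)))) mod-refl)
    (mod-trans (≈⇒mod (R.*-assoc _ _ _))
    (mod-trans (3*-mod (mod-* (mod-refl {s}) p))
    (mod-trans (≈⇒mod (R.sym (R.*-assoc _ _ _)))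
      (mod-* (≈⇒mod (proj₂ (third 1-xx≈0))) mod-refl)))))

  t = fixpoint f f-contractive
  t-fixed = fixpoint-fixed f f-contractive

  lem : ∀ t x → (t ℤ.* x) ℤ.* x ℤ.- + 1 ≡
    + 1 ℤ.* (t ℤ.- (+ 1 ℤ.+ (+ 1 ℤ.- x ℤ.* x) ℤ.* t))
  lem = solve-∀

≈1⇒unit : ∀ {x} → x ≈ ⟨ 1 ⟩ [mod3^ 1 ] → IsUnit x
≈1⇒unit x≈1 = square≈1⇒unit (mod-trans (mod-* x≈1 x≈1) (≈⇒mod (R.*-identityˡ 1#)))

≈2⇒unit : ∀ {x} → x ≈ ⟨ 2 ⟩ [mod3^ 1 ] → IsUnit x
≈2⇒unit x≈2 = square≈1⇒unit (mod-trans (mod-* x≈2 x≈2)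
  (at-level (congruent (divides (+ 1) refl))))

zero-or-unit : ∀ x → x ≈ 0# [mod3^ 1 ] ⊎ IsUnit x
zero-or-unit x = by-residue (residue x 1) (ℤ.n%ℕd<d (approx x 1) 3)
    (at-level (~-sym (residue-≡ x 1)))
  where
  by-residue : ∀ r → r ℕ.< 3 → x ≈ ⟨ r ⟩ [mod3^ 1 ] → x ≈ 0# [mod3^ 1 ] ⊎ IsUnit x
  by-residue 0 _ x≈0 = inj₁ x≈0
  by-residue 1 _ x≈1 = inj₂ (≈1⇒unit x≈1)
  by-residue 2 _ x≈2 = inj₂ (≈2⇒unit x≈2)
  by-residue (suc (suc (suc _))) (ℕ.s≤s (ℕ.s≤s (ℕ.s≤s ()))) _

unit-cancelʳ : ∀ {x y} → IsUnit y → x * y ≈ 0# → x ≈ 0#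
unit-cancelʳ {x} {y} (i , iy≈1) xy≈0 = begin
  x             ≈⟨ R.*-identityˡ x ⟨
  1# * x        ≈⟨ R.*-congʳ iy≈1 ⟨
  i * y * x     ≈⟨ R.*-assoc _ _ _ ⟩
  i * (y * x)   ≈⟨ R.*-congˡ (R.trans (R.*-comm y x) xy≈0) ⟩
  i * 0#        ≈⟨ R.zeroʳ i ⟩
  0#            ∎
  where open ≈-Reasoning R.setoid

-- Descent on the level: either `y` is a unit, or `y = 3t` with `t` nonzero one level lower.
*-cancelʳ-mod : ∀ n {x y} → ¬ (y ≈ 0# [mod3^ n ]) → x * y ≈ 0# → x ≈ 0#
*-cancelʳ-mod zero    y≉0 xy≈0 = contradiction mod-0 y≉0
*-cancelʳ-mod (suc n) {x} {y} y≉0 xy≈0 with zero-or-unit y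
... | inj₂ y-unit = unit-cancelʳ y-unit xy≈0
... | inj₁ 3∣y = let (t , 3t≈y) = third 3∣y in
  *-cancelʳ-mod n
    (λ t≈0 → y≉0 (mod-trans (≈⇒mod (R.sym 3t≈y))
      (mod-trans (3*-mod t≈0) (≈⇒mod (R.zeroʳ _)))))
    (3*-cancel (begin
      ⟨ 3 ⟩ * (x * t)   ≈⟨ ≗⇒≈ (λ n → lem (approx x n) (approx t n)) ⟩
      x * (⟨ 3 ⟩ * t)   ≈⟨ R.*-congˡ 3t≈y ⟩
      x * y             ≈⟨ xy≈0 ⟩
      0#                ≈⟨ R.zeroʳ ⟨ 3 ⟩ ⟨
      ⟨ 3 ⟩ * 0#        ∎))
  where
  open ≈-Reasoning R.setoid
  lem : ∀ x t → + 3 ℤ.* (x ℤ.* t) ≡ x ℤ.* (+ 3 ℤ.* t)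
  lem = solve-∀

-- From `¬ (y ≈ 0#)` no level at which `y` is nonzero can be read off. Instead, if `x` were nonzero,
-- cancellation at each level would force `y` to vanish there.
*-cancelʳ-≈0 : ∀ {x y} → ¬ (y ≈ 0#) → x * y ≈ 0# → x ≈ 0#
*-cancelʳ-≈0 y≉0 xy≈0 = ≈-stable λ x≉0 → y≉0 (mod⇒≈ λ n →
  decidable-stable mod? (λ y≉0-mod → x≉0 (*-cancelʳ-mod n y≉0-mod xy≈0)))

-- Factorials

fact : ℕ → ℤ₃
fact zero    = 1#
fact (suc n) = ⟨ suc n ⟩ * fact n

⟨+3*⟩ : ∀ r i → ⟨ r ℕ.+ i ℕ.* 3 ⟩ ≈ ⟨ r ⟩ [mod3^ 1 ]
⟨+3*⟩ r i = at-level (congruent (divides (+ i)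
  (trans (cong (ℤ._- + r) (trans (ℤ.pos-+ r (i ℕ.* 3)) (cong (λ t → + r ℤ.+ t) (ℤ.pos-* i 3))))
    (lem (+ r) (+ i)))))
  where
  lem : ∀ r i → (r ℤ.+ i ℤ.* + 3) ℤ.- r ≡ i ℤ.* + 3
  lem = solve-∀

unit-1+3* : ∀ i → IsUnit ⟨ 1 ℕ.+ i ℕ.* 3 ⟩
unit-1+3* i = ≈1⇒unit (⟨+3*⟩ 1 i)

unit-2+3* : ∀ i → IsUnit ⟨ 2 ℕ.+ i ℕ.* 3 ⟩
unit-2+3* i = ≈2⇒unit (⟨+3*⟩ 2 i)

-- Among the factors of `(3i)!` the multiples of 3 contribute `3ⁱ i!`. All others are units, and `f`
-- is the product of their inverses.
fact-3* : ∀ i → ∃ λ f → f * fact (i ℕ.* 3) ≈ 3^[ i ] * fact i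
fact-3* zero = 1# , R.refl
fact-3* (suc i) =
  let
    (f , f-eq) = fact-3* i
    (s , s-eq) = unit-1+3* i
    (t , t-eq) = unit-2+3* i
    A = ⟨ 1 ℕ.+ i ℕ.* 3 ⟩
    B = ⟨ 2 ℕ.+ i ℕ.* 3 ⟩
    C = ⟨ 3 ℕ.+ i ℕ.* 3 ⟩
    X = fact (i ℕ.* 3)
  in
  f * (s * t) , (begin
    f * (s * t) * (C * (B * (A * X)))
      ≈⟨ ≗⇒≈ (λ n → lem₁ (approx f n) (approx s n) (approx t n)
          (approx A n) (approx B n) (approx C n) (approx X n)) ⟩
    C * ((s * A) * (t * B)) * (f * X)
      ≈⟨ R.*-cong (R.*-cong (≗⇒≈ λ _ → ℤ.pos-* (suc i) 3) (R.*-cong s-eq t-eq)) f-eq ⟩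
    ⟨ suc i ⟩ * ⟨ 3 ⟩ * (1# * 1#) * (3^[ i ] * fact i)
      ≈⟨ ≗⇒≈ (λ n → lem₂ (approx ⟨ suc i ⟩ n) (approx 3^[ i ] n) (approx (fact i) n)) ⟩
    ⟨ 3 ⟩ * 3^[ i ] * (⟨ suc i ⟩ * fact i)
      ≈⟨ R.*-congʳ (3^[+] 1 i) ⟨
    3^[ suc i ] * (⟨ suc i ⟩ * fact i) ∎)
  where
  open ≈-Reasoning R.setoid
  lem₁ : ∀ f s t a b c x → f ℤ.* (s ℤ.* t) ℤ.* (c ℤ.* (b ℤ.* (a ℤ.* x))) ≡
    c ℤ.* ((s ℤ.* a) ℤ.* (t ℤ.* b)) ℤ.* (f ℤ.* x)
  lem₁ = solve-∀
  lem₂ : ∀ c p x → c ℤ.* + 3 ℤ.* (+ 1 ℤ.* + 1) ℤ.* (p ℤ.* x) ≡ + 3 ℤ.* p ℤ.* (c ℤ.* x)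
  lem₂ = solve-∀

unit-* : ∀ {f x y c} → f * x ≈ c → IsUnit y → ∃ λ g → g * (y * x) ≈ c
unit-* {f} {x} {y} {c} fx≈c (i , iy≈1) = f * i , (begin
  f * i * (y * x)     ≈⟨ ≗⇒≈ (λ n → lem (approx f n) (approx i n) (approx y n) (approx x n)) ⟩
  (i * y) * (f * x)   ≈⟨ R.*-cong iy≈1 fx≈c ⟩
  1# * c              ≈⟨ R.*-identityˡ c ⟩
  c                   ∎)
  where
  open ≈-Reasoning R.setoid
  lem : ∀ f i y x → f ℤ.* i ℤ.* (y ℤ.* x) ≡ (i ℤ.* y) ℤ.* (f ℤ.* x)
  lem = solve-∀

fact-+3* : ∀ r i → r ℕ.< 3 → ∃ λ f → f * fact (r ℕ.+ i ℕ.* 3) ≈ 3^[ i ] * fact i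
fact-+3* 0 i _ = fact-3* i
fact-+3* 1 i _ = unit-* (proj₂ (fact-3* i)) (unit-1+3* i)
fact-+3* 2 i _ = unit-* (proj₂ (unit-* (proj₂ (fact-3* i)) (unit-1+3* i))) (unit-2+3* i)
fact-+3* (suc (suc (suc _))) i (ℕ.s≤s (ℕ.s≤s (ℕ.s≤s ())))

-- Legendre's bound 2 v₃(n!) ≤ n - 1 for n ≥ 1.
FactBound : ℕ → Set
FactBound n = ∃₂ λ e k → e * fact n ≈ 3^[ k ] × k ℕ.+ k ℕ.≤ ℕ.pred n

-- Strong induction along `n ↦ n / 3`: for `n = r + 3i` with `r < 3`, the exponent for `n!` is
-- `i + k`, with `k` the exponent for `i!`. For `i ≥ 1`, `2k ≤ i - 1` gives
-- `2(i + k) ≤ 3i - 1 ≤ n - 1`.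
fact-bound : ∀ n → FactBound n
fact-bound = <-rec FactBound step
  where
  valuation-bound : ∀ r i k → k ℕ.+ k ℕ.≤ ℕ.pred i →
    (i ℕ.+ k) ℕ.+ (i ℕ.+ k) ℕ.≤ ℕ.pred (r ℕ.+ i ℕ.* 3)
  valuation-bound r zero    zero    _ = ℕ.z≤n
  valuation-bound r zero    (suc k) ()
  valuation-bound r (suc j) k       2k≤j = begin
    (suc j ℕ.+ k) ℕ.+ (suc j ℕ.+ k)   ≡⟨ rearrange j k ⟩
    2 ℕ.+ (j ℕ.* 2 ℕ.+ (k ℕ.+ k))     ≤⟨ ℕ.+-monoʳ-≤ 2 (ℕ.+-monoʳ-≤ (j ℕ.* 2) 2k≤j) ⟩
    2 ℕ.+ (j ℕ.* 2 ℕ.+ j)             ≡⟨ cong (2 ℕ.+_) (triple j) ⟩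
    2 ℕ.+ j ℕ.* 3                     ≤⟨ ℕ.pred-mono-≤ (ℕ.m≤n+m (suc j ℕ.* 3) r) ⟩
    ℕ.pred (r ℕ.+ suc j ℕ.* 3)        ∎
    where
    open ℕ.≤-Reasoning
    rearrange : ∀ j k → (suc j ℕ.+ k) ℕ.+ (suc j ℕ.+ k) ≡ 2 ℕ.+ (j ℕ.* 2 ℕ.+ (k ℕ.+ k))
    rearrange = ℕ-Solver.solve-∀
    triple : ∀ j → j ℕ.* 2 ℕ.+ j ≡ j ℕ.* 3
    triple = ℕ-Solver.solve-∀

  step : ∀ n → (∀ {m} → m ℕ.< n → FactBound m) → FactBound n
  step zero    rec = 1# , 0 , R.*-identityˡ 1# , ℕ.z≤n
  step (suc n) rec =
    let
      r = suc n ℕ.% 3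
      i = suc n ℕ./ 3
      n≡ = ℕ.m≡m%n+[m/n]*n (suc n) 3
      (f , f-eq) = fact-+3* r i (ℕ.m%n<n (suc n) 3)
      (e , k , e-eq , 2k≤) = rec (ℕ.m/n<m (suc n) 3 (ℕ.s≤s (ℕ.s≤s ℕ.z≤n)))
    in
    subst FactBound (sym n≡)
      ( e * f , i ℕ.+ k
      , (begin
          e * f * fact (r ℕ.+ i ℕ.* 3)     ≈⟨ R.*-assoc _ _ _ ⟩
          e * (f * fact (r ℕ.+ i ℕ.* 3))   ≈⟨ R.*-congˡ f-eq ⟩
          e * (3^[ i ] * fact i)           ≈⟨ x∙yz≈y∙xz _ _ _ ⟩
          3^[ i ] * (e * fact i)           ≈⟨ R.*-congˡ e-eq ⟩
          3^[ i ] * 3^[ k ]                ≈⟨ 3^[+] i k ⟨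
          3^[ i ℕ.+ k ]                    ∎)
      , valuation-bound r i k 2k≤)
    where open ≈-Reasoning R.setoid

-- Multiplying by `e` turns `n!` into a power of 3, which can be cancelled.
fact-cancelʳ : ∀ n {x y} → x * fact n ≈ y * fact n → x ≈ y
fact-cancelʳ n {x} {y} p =
  let
    (e , k , e-eq , _) = fact-bound n
    swap = λ z → begin
      3^[ k ] * z        ≈⟨ R.*-congʳ e-eq ⟨
      e * fact n * z     ≈⟨ R.*-assoc _ _ _ ⟩
      e * (fact n * z)   ≈⟨ R.*-congˡ (R.*-comm _ _) ⟩
      e * (z * fact n)   ∎
  in 3^*-cancel k (R.trans (swap x) (R.trans (R.*-congˡ p) (R.sym (swap y))))
  where open ≈-Reasoning R.setoid

-- The series for ι

-- The hypotheses give `2(n + k) ≤ 2i + 3`, and the right side is odd. The bound on `2k` is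
-- Legendre's for `(4 + i)!`.
double-bound : ∀ i k → k ℕ.+ k ℕ.≤ 3 ℕ.+ i → ∀ n → n ℕ.* 2 ℕ.≤ i → n ℕ.+ k ℕ.≤ suc i
double-bound i k 2k≤ n 2n≤i = ℕ.≮⇒≥ λ 1+i<n+k → ℕ.<-irrefl refl (begin-strict
  3 ℕ.+ (i ℕ.+ i)             <⟨ ℕ.≤-reflexive (lem₁ i) ⟩
  (2 ℕ.+ i) ℕ.+ (2 ℕ.+ i)     ≤⟨ ℕ.+-mono-≤ 1+i<n+k 1+i<n+k ⟩
  (n ℕ.+ k) ℕ.+ (n ℕ.+ k)     ≡⟨ lem₂ n k ⟩
  (k ℕ.+ k) ℕ.+ n ℕ.* 2       ≤⟨ ℕ.+-mono-≤ 2k≤ 2n≤i ⟩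
  3 ℕ.+ (i ℕ.+ i)             ∎)
  where
  open ℕ.≤-Reasoning
  lem₁ : ∀ i → 4 ℕ.+ (i ℕ.+ i) ≡ (2 ℕ.+ i) ℕ.+ (2 ℕ.+ i)
  lem₁ = ℕ-Solver.solve-∀
  lem₂ : ∀ n k → (n ℕ.+ k) ℕ.+ (n ℕ.+ k) ≡ (k ℕ.+ k) ℕ.+ n ℕ.* 2
  lem₂ = ℕ-Solver.solve-∀

-- With `k` the exponent for `(4 + i)!`, the quotient `2 · 3ⁱ⁺¹ / (4 + i)!` is a multiple of `3ᵈ`,
-- where `d = i + 1 - k`. Legendre's bound makes `d` nonnegative and at least `n` once `i ≥ 2n`.
tail-coeff-exists : ∀ i → ∃ λ b →
  b * fact (4 ℕ.+ i) ≈ ⟨ 2 ⟩ * 3^[ suc i ] × (∀ n → n ℕ.* 2 ℕ.≤ i → b ≈ 0# [mod3^ n ])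
tail-coeff-exists i =
  let
    (e , k , e-eq , 2k≤) = fact-bound (4 ℕ.+ i)
    d = suc i ℕ.∸ k
  in
    ⟨ 2 ⟩ * 3^[ d ] * e
  , (begin
      ⟨ 2 ⟩ * 3^[ d ] * e * fact (4 ℕ.+ i)     ≈⟨ R.*-assoc _ _ _ ⟩
      ⟨ 2 ⟩ * 3^[ d ] * (e * fact (4 ℕ.+ i))   ≈⟨ R.*-congˡ e-eq ⟩
      ⟨ 2 ⟩ * 3^[ d ] * 3^[ k ]                ≈⟨ R.*-assoc _ _ _ ⟩
      ⟨ 2 ⟩ * (3^[ d ] * 3^[ k ])              ≈⟨ R.*-congˡ (3^[+] d k) ⟨
      ⟨ 2 ⟩ * 3^[ d ℕ.+ k ]
        ≡⟨ cong (λ m → ⟨ 2 ⟩ * 3^[ m ]) (ℕ.m∸n+n≡m (double-bound i k 2k≤ 0 ℕ.z≤n)) ⟩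
      ⟨ 2 ⟩ * 3^[ suc i ]                      ∎)
  , λ n 2n≤i →
      mod-trans
        (mod-* (mod-* mod-refl (3^[]≈0 (ℕ.m+n≤o⇒m≤o∸n n (double-bound i k 2k≤ n 2n≤i)))) mod-refl)
        (≈⇒mod (R.trans (R.*-congʳ (R.zeroʳ _)) (R.zeroˡ _)))
  where
  open ≈-Reasoning R.setoid

tail-coeff : ℕ → ℤ₃
tail-coeff i = proj₁ (tail-coeff-exists i)

tail-coeff≈0 : ∀ {i} n → n ℕ.* 2 ℕ.≤ i → tail-coeff i ≈ 0# [mod3^ n ]
tail-coeff≈0 {i} = proj₂ (proj₂ (tail-coeff-exists i))

-- coeff j = 2 · 3ʲ / (j + 2)! and tail-coeff i = coeff (i + 2) / 3.
coeff : ℕ → ℤ₃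
coeff 0             = 1#
coeff 1             = 1#
coeff (suc (suc i)) = ⟨ 3 ⟩ * tail-coeff i

coeff-fact : ∀ j → coeff j * fact (2 ℕ.+ j) ≈ ⟨ 2 ⟩ * 3^[ j ]
coeff-fact 0             = ≗⇒≈ λ _ → refl
coeff-fact 1             = ≗⇒≈ λ _ → refl
coeff-fact (suc (suc i)) = begin
  ⟨ 3 ⟩ * tail-coeff i * fact (4 ℕ.+ i)     ≈⟨ R.*-assoc _ _ _ ⟩
  ⟨ 3 ⟩ * (tail-coeff i * fact (4 ℕ.+ i))   ≈⟨ R.*-congˡ (proj₁ (proj₂ (tail-coeff-exists i))) ⟩
  ⟨ 3 ⟩ * (⟨ 2 ⟩ * 3^[ suc i ])             ≈⟨ x∙yz≈y∙xz _ _ _ ⟩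
  ⟨ 2 ⟩ * (⟨ 3 ⟩ * 3^[ suc i ])             ≈⟨ R.*-congˡ (3^[+] 1 (suc i)) ⟨
  ⟨ 2 ⟩ * 3^[ 2 ℕ.+ i ]                     ∎
  where open ≈-Reasoning R.setoid

-- Clearing the denominator `(j + 2)!` reduces this to the closed form. It lets the difference of
-- one term of the series cancel against `3u` times the preceding term.
coeff-recurrence : ∀ j → coeff (suc j) * ⟨ 3 ℕ.+ j ⟩ ≈ ⟨ 3 ⟩ * coeff j
coeff-recurrence j = fact-cancelʳ (2 ℕ.+ j) (begin
  coeff (suc j) * ⟨ 3 ℕ.+ j ⟩ * fact (2 ℕ.+ j)   ≈⟨ R.*-assoc _ _ _ ⟩
  coeff (suc j) * fact (3 ℕ.+ j)                 ≈⟨ coeff-fact (suc j) ⟩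
  ⟨ 2 ⟩ * 3^[ suc j ]                            ≈⟨ R.*-congˡ (3^[+] 1 j) ⟩
  ⟨ 2 ⟩ * (⟨ 3 ⟩ * 3^[ j ])                      ≈⟨ x∙yz≈y∙xz _ _ _ ⟩
  ⟨ 3 ⟩ * (⟨ 2 ⟩ * 3^[ j ])                      ≈⟨ R.*-congˡ (coeff-fact j) ⟨
  ⟨ 3 ⟩ * (coeff j * fact (2 ℕ.+ j))             ≈⟨ R.*-assoc _ _ _ ⟨
  ⟨ 3 ⟩ * coeff j * fact (2 ℕ.+ j)               ∎)
  where open ≈-Reasoning R.setoid

-- Falling factorials and the partial sums of the series

falling : ℤ₃ → ℕ → ℤ₃
falling z zero    = 1#
falling z (suc n) = z * falling (z - 1#) n

falling-mod : ∀ {z z′ n} → z ≈ z′ [mod3^ n ] → ∀ k →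
  falling z k ≈ falling z′ k [mod3^ n ]
falling-mod p zero    = mod-refl
falling-mod p (suc k) = mod-* p (falling-mod (mod-+ p mod-refl) k)

falling-cong : ∀ {z z′} → z ≈ z′ → ∀ k → falling z k ≈ falling z′ k
falling-cong p k = mod⇒≈ λ n → falling-mod (≈⇒mod p) k

falling-suc : ∀ z n → falling z (suc n) ≈ falling z n * (z - ⟨ n ⟩)
falling-suc z zero    = ≗⇒≈ λ n → lem (approx z n)
  where
  lem : ∀ z → z ℤ.* + 1 ≡ + 1 ℤ.* (z ℤ.- + 0)
  lem = solve-∀
falling-suc z (suc n) = begin
  z * falling (z - 1#) (suc n)                    ≈⟨ R.*-congˡ (falling-suc (z - 1#) n) ⟩
  z * (falling (z - 1#) n * (z - 1# - ⟨ n ⟩))     ≈⟨ R.*-assoc _ _ _ ⟨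
  z * falling (z - 1#) n * (z - 1# - ⟨ n ⟩)
    ≈⟨ R.*-congˡ (combination 1# (⟨suc⟩ n) (≗⇒≈ λ m → lem (approx z m) (+ n) (+ suc n))) ⟩
  z * falling (z - 1#) n * (z - ⟨ suc n ⟩)        ∎
  where
  open ≈-Reasoning R.setoid
  lem : ∀ z n n′ → (z ℤ.- + 1 ℤ.- n) ℤ.- (z ℤ.- n′) ≡ + 1 ℤ.* (n′ ℤ.- (n ℤ.+ + 1))
  lem = solve-∀

-- The power rule of the difference calculus.
falling-difference : ∀ z n →
  falling (z + 1#) (suc n) ≈ falling z (suc n) + ⟨ suc n ⟩ * falling z n
falling-difference z n = begin
  (z + 1#) * falling (z + 1# - 1#) n
    ≈⟨ R.*-congˡ (falling-cong (≗⇒≈ λ m → lem₁ (approx z m)) n) ⟩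
  (z + 1#) * falling z n
    ≈⟨ ≗⇒≈ (λ m → lem₂ (approx z m) (approx (falling z n) m) (+ n)) ⟩
  falling z n * (z - ⟨ n ⟩) + (⟨ n ⟩ + 1#) * falling z n
    ≈⟨ R.+-cong (falling-suc z n) (R.*-congʳ (⟨suc⟩ n)) ⟨
  falling z (suc n) + ⟨ suc n ⟩ * falling z n   ∎
  where
  open ≈-Reasoning R.setoid
  lem₁ : ∀ z → z ℤ.+ + 1 ℤ.- + 1 ≡ z
  lem₁ = solve-∀
  lem₂ : ∀ z f n → (z ℤ.+ + 1) ℤ.* f ≡ f ℤ.* (z ℤ.- n) ℤ.+ (n ℤ.+ + 1) ℤ.* f
  lem₂ = solve-∀

sum : (ℕ → ℤ₃) → ℕ → ℤ₃
sum t zero    = 0#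
sum t (suc n) = sum t n + t n

-- P u z n is the partial sum of z (z - 1) h(u, z), by P-factor below.
P-term : ℤ₃ → ℤ₃ → ℕ → ℤ₃
P-term u z j = coeff j * (u ^ j * falling z (2 ℕ.+ j))

P : ℤ₃ → ℤ₃ → ℕ → ℤ₃
P u z = sum (P-term u z)

-- This mirrors `ι(z + 1) = 1 + q ι(z)` under `2 (ι(z) - z) = 3 u P`. Differencing lowers the degree
-- of each term by one, so the last `P` is one term shorter; the term `j = 0` yields `2z`.
P-recurrence : ∀ u z n →
  P u (z + 1#) (suc n) ≈ P u z (suc n) + ⟨ 2 ⟩ * z + ⟨ 3 ⟩ * u * P u z n
P-recurrence u z zero = ≗⇒≈ λ m → lem (approx z m) (approx u m)
  where
  lem : ∀ z u →
    + 0 ℤ.+ + 1 ℤ.* (+ 1 ℤ.* ((z ℤ.+ + 1) ℤ.* ((z ℤ.+ + 1 ℤ.- + 1) ℤ.* + 1))) ≡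
    + 0 ℤ.+ + 1 ℤ.* (+ 1 ℤ.* (z ℤ.* ((z ℤ.- + 1) ℤ.* + 1))) ℤ.+ + 2 ℤ.* z
      ℤ.+ + 3 ℤ.* u ℤ.* + 0
  lem = solve-∀
P-recurrence u z (suc n) = begin
  P u (z + 1#) (suc n) + A * (U * falling (z + 1#) (3 ℕ.+ n))
    ≈⟨ R.+-cong (P-recurrence u z n) (R.*-congˡ (R.*-congˡ (falling-difference z (2 ℕ.+ n)))) ⟩
  P u z (suc n) + ⟨ 2 ⟩ * z + ⟨ 3 ⟩ * u * P u z n + A * (U * (f₃ + ⟨ 3 ℕ.+ n ⟩ * f₂))
    ≈⟨ combination (U * f₂) (coeff-recurrence n) (≗⇒≈ λ m → lem (approx (P u z (suc n)) m)
        (approx z m) (approx u m) (approx (P u z n) m) (approx A m) (approx (u ^ n) m)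
        (approx f₃ m) (approx ⟨ 3 ℕ.+ n ⟩ m) (approx f₂ m) (approx (coeff n) m)) ⟩
  (P u z (suc n) + A * (U * f₃)) + ⟨ 2 ⟩ * z + ⟨ 3 ⟩ * u * (P u z n + coeff n * (u ^ n * f₂)) ∎
  where
  open ≈-Reasoning R.setoid
  A  = coeff (suc n)
  U  = u ^ suc n
  f₂ = falling z (2 ℕ.+ n)
  f₃ = falling z (3 ℕ.+ n)
  lem : ∀ p₁ z u p A v f₃ k f₂ a →
    (p₁ ℤ.+ + 2 ℤ.* z ℤ.+ + 3 ℤ.* u ℤ.* p ℤ.+ A ℤ.* ((u ℤ.* v) ℤ.* (f₃ ℤ.+ k ℤ.* f₂)))
      ℤ.- (p₁ ℤ.+ A ℤ.* ((u ℤ.* v) ℤ.* f₃) ℤ.+ + 2 ℤ.* z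
             ℤ.+ + 3 ℤ.* u ℤ.* (p ℤ.+ a ℤ.* (v ℤ.* f₂)))
    ≡ ((u ℤ.* v) ℤ.* f₂) ℤ.* (A ℤ.* k ℤ.- + 3 ℤ.* a)
  lem = solve-∀

-- The remainder series R

R-term : ℤ₃ → ℤ₃ → ℕ → ℤ₃
R-term u z i = tail-coeff i * (u ^ (2 ℕ.+ i) * falling (z - 1# - 1#) (2 ℕ.+ i))

-- The i-th term is known to vanish modulo 3ⁿ from `i = 2n` on, so `2n` terms settle the sum modulo
-- 3ⁿ.
R-partial : ℤ₃ → ℤ₃ → ℕ → ℤ₃
R-partial u z n = sum (R-term u z) (n ℕ.* 2)

R-term≈0 : ∀ u z {i} n → n ℕ.* 2 ℕ.≤ i → R-term u z i ≈ 0# [mod3^ n ]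
R-term≈0 u z n 2n≤i = mod-trans (mod-* (tail-coeff≈0 n 2n≤i) mod-refl) (≈⇒mod (R.zeroˡ _))

R-cauchy : ∀ u z n → R-partial u z (suc n) ≈ R-partial u z n [mod3^ n ]
R-cauchy u z n = mod-trans
  (mod-+ (mod-+ mod-refl (R-term≈0 u z n ℕ.≤-refl)) (R-term≈0 u z n (ℕ.n≤1+n _)))
  (≈⇒mod (R.trans (R.+-identityʳ _) (R.+-identityʳ _)))

abstract
  remainder : ℤ₃ → ℤ₃ → ℤ₃
  remainder u z = limit (R-partial u z) (R-cauchy u z)

  remainder-partial : ∀ u z n → remainder u z ≈ R-partial u z n [mod3^ n ]
  remainder-partial u z = limit-mod (R-partial u z) (R-cauchy u z)

-- Modulo 3ⁿ both sides are the same finite sum of polynomials over ℤ₃, evaluated at congruent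
-- arguments.
remainder-mod : ∀ {u u′ z z′ n} → u ≈ u′ [mod3^ n ] → z ≈ z′ [mod3^ n ] →
  remainder u z ≈ remainder u′ z′ [mod3^ n ]
remainder-mod {u} {u′} {z} {z′} {n} p q =
  mod-trans (remainder-partial u z n)
    (mod-trans (sum-mod (n ℕ.* 2))
      (mod-sym (remainder-partial u′ z′ n)))
  where
  sum-mod : ∀ k → sum (R-term u z) k ≈ sum (R-term u′ z′) k [mod3^ n ]
  sum-mod zero    = mod-refl
  sum-mod (suc k) = mod-+ (sum-mod k) (mod-* mod-refl (mod-* (mod-^ p (2 ℕ.+ k))
    (falling-mod (mod-+ (mod-+ q mod-refl) mod-refl) (2 ℕ.+ k))))

-- The recursion of `falling` through `z - 1#` exposes the factors `z` and `z - 1#` of every term by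
-- computation. From the third term on, `coeff` also supplies a factor 3, and `R-term` is what is
-- left.
P-factor : ∀ u z n →
  P u z (2 ℕ.+ n) ≈
    z * (z - 1#) * (1# + (z - 1# - 1#) * u + ⟨ 3 ⟩ * sum (R-term u z) n)
P-factor u z zero = ≗⇒≈ λ m → lem (approx z m) (approx u m)
  where
  lem : ∀ z u →
    + 0 ℤ.+ + 1 ℤ.* (+ 1 ℤ.* (z ℤ.* ((z ℤ.- + 1) ℤ.* + 1)))
      ℤ.+ + 1 ℤ.* (u ℤ.* + 1 ℤ.* (z ℤ.* ((z ℤ.- + 1) ℤ.* ((z ℤ.- + 1 ℤ.- + 1) ℤ.* + 1)))) ≡
    z ℤ.* (z ℤ.- + 1) ℤ.* (+ 1 ℤ.+ (z ℤ.- + 1 ℤ.- + 1) ℤ.* u ℤ.+ + 3 ℤ.* + 0)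
  lem = solve-∀
P-factor u z (suc n) = R.trans (R.+-congʳ (P-factor u z n))
  (≗⇒≈ λ m → lem (approx z m) (approx u m) (approx (sum (R-term u z) n) m) (approx (tail-coeff n) m)
    (approx (u ^ (2 ℕ.+ n)) m) (approx (falling (z - 1# - 1#) (2 ℕ.+ n)) m))
  where
  lem : ∀ z u r b v f →
    z ℤ.* (z ℤ.- + 1) ℤ.* (+ 1 ℤ.+ (z ℤ.- + 1 ℤ.- + 1) ℤ.* u ℤ.+ + 3 ℤ.* r)
      ℤ.+ + 3 ℤ.* b ℤ.* (v ℤ.* (z ℤ.* ((z ℤ.- + 1) ℤ.* f))) ≡
    z ℤ.* (z ℤ.- + 1) ℤ.*
      (+ 1 ℤ.+ (z ℤ.- + 1 ℤ.- + 1) ℤ.* u ℤ.+ + 3 ℤ.* (r ℤ.+ b ℤ.* (v ℤ.* f)))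
  lem = solve-∀

P-mod : ∀ u {z z′ n} → z ≈ z′ [mod3^ n ] → ∀ k → P u z k ≈ P u z′ k [mod3^ n ]
P-mod u p zero    = mod-refl
P-mod u p (suc k) = mod-+ (P-mod u p k)
  (mod-* mod-refl (mod-* mod-refl (falling-mod p (2 ℕ.+ k))))

-- The additional term has coefficient `⟨ 3 ⟩ * tail-coeff (n * 2)`, which vanishes modulo 3ⁿ. This
-- evens out the unequal lengths in `P-recurrence`.
P-stable : ∀ u z n → P u z (3 ℕ.+ n ℕ.* 2) ≈ P u z (2 ℕ.+ n ℕ.* 2) [mod3^ n ]
P-stable u z n = mod-trans
  (mod-+ mod-refl
    (mod-* (mod-trans (mod-* mod-refl (tail-coeff≈0 n ℕ.≤-refl)) (≈⇒mod (R.zeroʳ _))) mod-refl))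
  (≈⇒mod (R.trans (R.+-congˡ (R.zeroˡ _)) (R.+-identityʳ _)))

P-step : ∀ u k n → let N = 2 ℕ.+ n ℕ.* 2 in
  P u ⟨ suc k ⟩ N ≈ P u ⟨ k ⟩ N + ⟨ 2 ⟩ * ⟨ k ⟩ + ⟨ 3 ⟩ * u * P u ⟨ k ⟩ N [mod3^ n ]
P-step u k n = begin
  P u ⟨ suc k ⟩ N          ≈⟨ P-mod u (≈⇒mod (⟨suc⟩ k)) N ⟩
  P u (⟨ k ⟩ + 1#) N       ≈⟨ P-stable u (⟨ k ⟩ + 1#) n ⟨
  P u (⟨ k ⟩ + 1#) (suc N) ≈⟨ ≈⇒mod (P-recurrence u ⟨ k ⟩ N) ⟩
  P u ⟨ k ⟩ (suc N) + ⟨ 2 ⟩ * ⟨ k ⟩ + ⟨ 3 ⟩ * u * P u ⟨ k ⟩ N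
    ≈⟨ mod-+ (mod-+ (P-stable u ⟨ k ⟩ n) mod-refl) mod-refl ⟩
  P u ⟨ k ⟩ N + ⟨ 2 ⟩ * ⟨ k ⟩ + ⟨ 3 ⟩ * u * P u ⟨ k ⟩ N ∎
  where
  open ≈-Reasoning (mod-setoid n)
  N = 2 ℕ.+ n ℕ.* 2

-- Geometric sums, ι and the zeros of h

module _ {q u : ℤ₃} (q≈1+3u : q ≈ 1# + ⟨ 3 ⟩ * u) where

  power-geometric : ∀ k → q ^ k ≈ 1# + ⟨ 3 ⟩ * u * geometric q k
  power-geometric zero    = ≗⇒≈ λ n → lem (approx u n)
    where
    lem : ∀ u → + 1 ≡ + 1 ℤ.+ + 3 ℤ.* u ℤ.* + 0
    lem = solve-∀
  power-geometric (suc k) = begin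
    q * q ^ k                                  ≈⟨ R.*-congʳ q≈1+3u ⟩
    (1# + ⟨ 3 ⟩ * u) * q ^ k
      ≈⟨ combination 1# (power-geometric k) (≗⇒≈ λ n →
          lem (approx u n) (approx (q ^ k) n) (approx (geometric q k) n)) ⟩
    1# + ⟨ 3 ⟩ * u * (geometric q k + q ^ k)   ∎
    where
    open ≈-Reasoning R.setoid
    lem : ∀ u v g →
      (+ 1 ℤ.+ + 3 ℤ.* u) ℤ.* v ℤ.- (+ 1 ℤ.+ + 3 ℤ.* u ℤ.* (g ℤ.+ v)) ≡
      + 1 ℤ.* (v ℤ.- (+ 1 ℤ.+ + 3 ℤ.* u ℤ.* g))
    lem = solve-∀

  -- Induction on `k`: both sides vanish at 0 and satisfy `X(k + 1) = X(k) + 3u (2k + X(k))` modulo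
  -- 3ⁿ.
  geometric-P : ∀ n k →
    ⟨ 2 ⟩ * (geometric q k - ⟨ k ⟩) ≈ ⟨ 3 ⟩ * u * P u ⟨ k ⟩ (2 ℕ.+ n ℕ.* 2) [mod3^ n ]
  geometric-P n zero = ≈⇒mod (R.sym (R.trans
    (R.*-congˡ (R.trans (P-factor u 0# (n ℕ.* 2)) (R.trans (R.*-congʳ (R.zeroˡ _)) (R.zeroˡ _))))
    (R.trans (R.zeroʳ _) (≗⇒≈ λ _ → refl))))
  geometric-P n (suc k) = begin
    ⟨ 2 ⟩ * (g + q ^ k - ⟨ suc k ⟩)
      ≈⟨ ≈⇒mod (R.*-congˡ (R.+-cong (R.+-congˡ (power-geometric k)) (R.-‿cong (⟨suc⟩ k)))) ⟩
    ⟨ 2 ⟩ * (g + (1# + ⟨ 3 ⟩ * u * g) - (⟨ k ⟩ + 1#))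
      ≈⟨ ≈⇒mod (≗⇒≈ λ m → lem₁ (approx u m) (approx g m) (+ k)) ⟩
    ⟨ 2 ⟩ * (g - ⟨ k ⟩) + ⟨ 3 ⟩ * u * (⟨ 2 ⟩ * ⟨ k ⟩ + ⟨ 2 ⟩ * (g - ⟨ k ⟩))
      ≈⟨ mod-+ (geometric-P n k) (mod-* mod-refl (mod-+ mod-refl (geometric-P n k))) ⟩
    ⟨ 3 ⟩ * u * p + ⟨ 3 ⟩ * u * (⟨ 2 ⟩ * ⟨ k ⟩ + ⟨ 3 ⟩ * u * p)
      ≈⟨ ≈⇒mod (≗⇒≈ λ m → lem₂ (approx u m) (approx p m) (+ k)) ⟩
    ⟨ 3 ⟩ * u * (p + ⟨ 2 ⟩ * ⟨ k ⟩ + ⟨ 3 ⟩ * u * p)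
      ≈⟨ mod-* mod-refl (P-step u k n) ⟨
    ⟨ 3 ⟩ * u * P u ⟨ suc k ⟩ (2 ℕ.+ n ℕ.* 2) ∎
    where
    open ≈-Reasoning (mod-setoid n)
    g = geometric q k
    p = P u ⟨ k ⟩ (2 ℕ.+ n ℕ.* 2)
    lem₁ : ∀ u g k →
      + 2 ℤ.* (g ℤ.+ (+ 1 ℤ.+ + 3 ℤ.* u ℤ.* g) ℤ.- (k ℤ.+ + 1)) ≡
      + 2 ℤ.* (g ℤ.- k) ℤ.+ + 3 ℤ.* u ℤ.* (+ 2 ℤ.* k ℤ.+ + 2 ℤ.* (g ℤ.- k))
    lem₁ = solve-∀
    lem₂ : ∀ u p k →
      + 3 ℤ.* u ℤ.* p ℤ.+ + 3 ℤ.* u ℤ.* (+ 2 ℤ.* k ℤ.+ + 3 ℤ.* u ℤ.* p) ≡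
      + 3 ℤ.* u ℤ.* (p ℤ.+ + 2 ℤ.* k ℤ.+ + 3 ℤ.* u ℤ.* p)
    lem₂ = solve-∀

h : ℤ₃ → ℤ₃ → ℤ₃
h u z = 1# + (z - 1# - 1#) * u + ⟨ 3 ⟩ * remainder u z

-- Modulo 3ⁿ, `ι` at `z` is by definition the geometric sum at the residue of `z`, and the right
-- side respects congruences in `z`. So the identity for natural numbers carries over.
ι-h : ∀ {q u} (q∈U : q ∈U^ 1) → q ≈ 1# + ⟨ 3 ⟩ * u → ∀ z →
  ⟨ 2 ⟩ * (ι q q∈U z - z) ≈ ⟨ 3 ⟩ * u * (z * (z - 1#) * h u z)
ι-h {q} {u} q∈U q≈1+3u z = mod⇒≈ λ n →
  let
    open ≈-Reasoning (mod-setoid n)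
    k = residue z n
    z≈k : z ≈ ⟨ k ⟩ [mod3^ n ]
    z≈k = at-level (~-sym (residue-≡ z n))
    z-1≈k-1 = mod-+ z≈k (mod-refl { - 1# })
    ι≈geometric : ι q q∈U z ≈ geometric q k [mod3^ n ]
    ι≈geometric = at-level ~-refl
  in begin
  ⟨ 2 ⟩ * (ι q q∈U z - z)              ≈⟨ mod-* mod-refl (mod-+ ι≈geometric (mod-neg z≈k)) ⟩
  ⟨ 2 ⟩ * (geometric q k - ⟨ k ⟩)      ≈⟨ geometric-P q≈1+3u n k ⟩
  ⟨ 3 ⟩ * u * P u ⟨ k ⟩ (2 ℕ.+ n ℕ.* 2)
    ≈⟨ mod-* mod-refl (≈⇒mod (P-factor u ⟨ k ⟩ (n ℕ.* 2))) ⟩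
  ⟨ 3 ⟩ * u * (⟨ k ⟩ * (⟨ k ⟩ - 1#) *
    (1# + (⟨ k ⟩ - 1# - 1#) * u + ⟨ 3 ⟩ * R-partial u ⟨ k ⟩ n))
    ≈⟨ mod-* mod-refl (mod-* (mod-* z≈k z-1≈k-1)
        (mod-+ (mod-+ mod-refl (mod-* (mod-+ z-1≈k-1 mod-refl) mod-refl))
          (mod-* mod-refl (mod-trans (remainder-mod (mod-refl {u}) z≈k)
            (remainder-partial u ⟨ k ⟩ n))))) ⟨
  ⟨ 3 ⟩ * u * (z * (z - 1#) * h u z)   ∎

module _ {q u : ℤ₃} (q∈U : q ∈U^ 1) (q≈1+3u : q ≈ 1# + ⟨ 3 ⟩ * u) (z : ℤ₃) where

  h≈0⇒fixed : h u z ≈ 0# → ι q q∈U z ≈ z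
  h≈0⇒fixed h≈0 = -≈0⇒≈ (unit-cancelʳ (≈2⇒unit mod-refl) (begin
    (ι q q∈U z - z) * ⟨ 2 ⟩               ≈⟨ R.*-comm _ _ ⟩
    ⟨ 2 ⟩ * (ι q q∈U z - z)               ≈⟨ ι-h q∈U q≈1+3u z ⟩
    ⟨ 3 ⟩ * u * (z * (z - 1#) * h u z)    ≈⟨ R.*-congˡ (R.*-congˡ h≈0) ⟩
    ⟨ 3 ⟩ * u * (z * (z - 1#) * 0#)       ≈⟨ R.*-congˡ (R.zeroʳ _) ⟩
    ⟨ 3 ⟩ * u * 0#                        ≈⟨ R.zeroʳ _ ⟩
    0#                                    ∎))
    where open ≈-Reasoning R.setoid

  fixed⇒h≈0 : IsUnit u → ¬ (z ≈ 0#) → ¬ (z ≈ 1#) → ι q q∈U z ≈ z → h u z ≈ 0#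
  fixed⇒h≈0 u-unit z≉0 z≉1 fixed =
    *-cancelʳ-≈0 z≉0 (*-cancelʳ-≈0 (z≉1 ∘ -≈0⇒≈) (unit-cancelʳ u-unit (3*-cancel (begin
      -- The factors are ordered for cancellation from the right: first `u`, then `z - 1#`, then
      -- `z`.
      ⟨ 3 ⟩ * (h u z * z * (z - 1#) * u)
        ≈⟨ ≗⇒≈ (λ n → lem (approx (h u z) n) (approx z n) (approx u n)) ⟩
      ⟨ 3 ⟩ * u * (z * (z - 1#) * h u z)   ≈⟨ ι-h q∈U q≈1+3u z ⟨
      ⟨ 2 ⟩ * (ι q q∈U z - z)              ≈⟨ R.*-congˡ (≈⇒-≈0 fixed) ⟩
      ⟨ 2 ⟩ * 0#                           ≈⟨ R.zeroʳ _ ⟩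
      0#                                   ≈⟨ R.zeroʳ _ ⟨
      ⟨ 3 ⟩ * 0#                           ∎))))
    where
    open ≈-Reasoning R.setoid
    lem : ∀ h z u → + 3 ℤ.* (h ℤ.* z ℤ.* (z ℤ.- + 1) ℤ.* u) ≡
      + 3 ℤ.* u ℤ.* (z ℤ.* (z ℤ.- + 1) ℤ.* h)
    lem = solve-∀

-- Isometries

Norm-resp : ∀ {d d′} → (d ≈ 0# → d′ ≈ 0#) → (∀ n → 3^[ n ] ∣ d ⇔ 3^[ n ] ∣ d′) →
  ∀ {r} → Norm d r → Norm d′ r
Norm-resp ≈0 ∣⇔∣ (inj₁ (d≈0 , r≡0)) = inj₁ (≈0 d≈0 , r≡0)
Norm-resp ≈0 ∣⇔∣ (inj₂ (n , 3ⁿ∣d , 3ⁿ⁺¹∤d , r≡)) = inj₂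
  (n , Equivalence.to (∣⇔∣ n) 3ⁿ∣d , 3ⁿ⁺¹∤d ∘ Equivalence.from (∣⇔∣ (suc n)) , r≡)

preserves-mod⇒preserves-distance : {f : ℤ₃ → ℤ₃} →
  (∀ n {x y} → x ≈ y [mod3^ n ] → f x ≈ f y [mod3^ n ]) →
  (∀ n {x y} → f x ≈ f y [mod3^ n ] → x ≈ y [mod3^ n ]) →
  ∀ x y r → Distance x y r ⇔ Distance (f x) (f y) r
preserves-mod⇒preserves-distance preserve reflect x y r = mk⇔
  (Norm-resp (λ d≈0 → ≈⇒-≈0 (mod⇒≈ λ n → preserve n (≈⇒mod (-≈0⇒≈ d≈0)))) ∣⇔∣)
  (Norm-resp (λ d≈0 → ≈⇒-≈0 (mod⇒≈ λ n → reflect n (≈⇒mod (-≈0⇒≈ d≈0)))) (⇔-sym ∘ ∣⇔∣))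
  where
  ∣⇔∣ = λ n → mk⇔ (λ p → mod-∣ n (preserve n (∣-mod n p)))
                  (λ p → mod-∣ n (reflect n (∣-mod n p)))

module _
  (M : ℤ₃ → ℤ₃ → ℤ₃)
  (M-contractive : ∀ {x x′ y y′ n} → x ≈ x′ [mod3^ n ] → y ≈ y′ [mod3^ n ] →
    M x y ≈ M x′ y′ [mod3^ suc n ])
  where

  contractiveˡ : ∀ x → Contractive (λ y → x + M x y)
  contractiveˡ x p = mod-+ mod-refl (M-contractive mod-refl p)

  contractiveʳ : ∀ y → Contractive (λ x → y - M x y)
  contractiveʳ y p = mod-+ mod-refl (mod-neg (M-contractive p mod-refl))

  module _ {f : ℤ₃ → ℤ₃} (f-solves : ∀ x → f x ≈ x + M x (f x)) where

    -- Agreement of the arguments and values modulo 3ⁿ makes the `M` terms agree modulo 3ⁿ⁺¹, which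
    -- carries the induction. `reflect` runs the same induction on `x = f x - M x (f x)`.
    preserve : ∀ n {x y} → x ≈ y [mod3^ n ] → f x ≈ f y [mod3^ n ]
    preserve zero    p = mod-0
    preserve (suc n) p = mod-trans (≈⇒mod (f-solves _))
      (mod-trans (mod-+ p (M-contractive (mod-pred p) (preserve n (mod-pred p))))
        (≈⇒mod (R.sym (f-solves _))))

    reflect : ∀ n {x y} → f x ≈ f y [mod3^ n ] → x ≈ y [mod3^ n ]
    reflect zero    p = mod-0
    reflect (suc n) p = mod-trans (≈⇒mod (transpose (f-solves _)))
      (mod-trans
        (mod-+ p (mod-neg (M-contractive (reflect n (mod-pred p)) (mod-pred p))))
        (≈⇒mod (R.sym (transpose (f-solves _)))))

    -- The preimage of `y` is the fixed point of the contraction `x ↦ y - M x y`. Then `y` and the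
    -- value of `f` there both solve `t = x + M x t`, whose solution is unique.
    surjective : Surjective _≈_ _≈_ f
    surjective y = x , λ {z} z≈x →
        fixpoint-unique (λ t → z + M z t) (contractiveˡ z) (f-solves z)
          (R.trans (transpose⁻ x-solves) (mod⇒≈ λ n →
            let x≈z = ≈⇒mod (R.sym z≈x)
            in mod-+ x≈z (mod-pred (M-contractive x≈z mod-refl))))
      where
      x = fixpoint (λ x → y - M x y) (contractiveʳ y)
      x-solves = fixpoint-fixed (λ x → y - M x y) (contractiveʳ y)

    implicit-isometry : IsIsometry f
    implicit-isometry = record
      { preserves-distance = preserves-mod⇒preserves-distance preserve reflect
      ; surjective         = surjective
      }

-- The branches of Φ

module _ (Φ : U¹-U² → ℤ₃) (Φ-fixed : IsFixedPointMap Φ) where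
  open IsFixedPointMap Φ-fixed

  -- The zeros of h (u x) are the solutions of z = c + 3 Y x z; with z = c + 3 y
  -- this reads y = x + M x y.
  module Branch
    (c : ℤ₃) (q : ℤ₃ → U¹-U²) (u : ℤ₃ → ℤ₃) (Y : ℤ₃ → ℤ₃ → ℤ₃)
    (q≈1+3u : ∀ x → elt (q x) ≈ 1# + ⟨ 3 ⟩ * u x)
    (u-unit : ∀ x → IsUnit (u x))
    (root⇒ : ∀ x z → h (u x) z ≈ 0# → z ≈ c + ⟨ 3 ⟩ * Y x z)
    (root⇐ : ∀ x z → z ≈ c + ⟨ 3 ⟩ * Y x z → h (u x) z ≈ 0#)
    (Y-cong : ∀ x {z z′} → z ≈ z′ → Y x z ≈ Y x z′)
    (M-contractive : ∀ {x x′ y y′ n} → x ≈ x′ [mod3^ n ] → y ≈ y′ [mod3^ n ] →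
      Y x (c + ⟨ 3 ⟩ * y) - x ≈ Y x′ (c + ⟨ 3 ⟩ * y′) - x′ [mod3^ suc n ])
    -- Here `c` is the trivial fixed point in the residue class `c + 3ℤ₃` of the branch; the other
    -- one is excluded by its residue modulo 3.
    (nontrivial⇒≉c : ∀ {z} → ¬ (z ≈ 0#) → ¬ (z ≈ 1#) → ¬ (z ≈ c))
    (≉c⇒nontrivial : ∀ {y} → ¬ (c + ⟨ 3 ⟩ * y ≈ c) →
      ¬ (c + ⟨ 3 ⟩ * y ≈ 0#) × ¬ (c + ⟨ 3 ⟩ * y ≈ 1#))
    (exceptional : ∀ x → IsExceptional (q x) → Φ (q x) ≈ c)
    where

    M : ℤ₃ → ℤ₃ → ℤ₃
    M x y = Y x (c + ⟨ 3 ⟩ * y) - x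

    y₀ : ℤ₃ → ℤ₃
    y₀ x = fixpoint (λ y → x + M x y) (contractiveˡ M M-contractive x)

    y₀-fixed : ∀ x → y₀ x ≈ x + M x (y₀ x)
    y₀-fixed x = fixpoint-fixed (λ y → x + M x y) (contractiveˡ M M-contractive x)

    z₀ : ℤ₃ → ℤ₃
    z₀ x = c + ⟨ 3 ⟩ * y₀ x

    x+M≈Y : ∀ x y → x + M x y ≈ Y x (c + ⟨ 3 ⟩ * y)
    x+M≈Y x y = ≗⇒≈ λ n → lem (approx x n) (approx (Y x (c + ⟨ 3 ⟩ * y)) n)
      where
      lem : ∀ x y → x ℤ.+ (y ℤ.- x) ≡ y
      lem = solve-∀

    h-z₀ : ∀ x → h (u x) (z₀ x) ≈ 0#
    h-z₀ x = root⇐ x (z₀ x)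
      (R.+-congˡ (R.*-congˡ (R.trans (y₀-fixed x) (x+M≈Y x (y₀ x)))))

    -- The equation `z = c + 3 Y x z` itself displays `z` in the form `c + 3y` with `y = Y x z`, and
    -- this `y` is a fixed point of the contraction defining `y₀`.
    root-unique : ∀ x z → h (u x) z ≈ 0# → z ≈ z₀ x
    root-unique x z hz≈0 = R.trans z≈ (R.+-congˡ (R.*-congˡ
      (fixpoint-unique (λ y → x + M x y) (contractiveˡ M M-contractive x)
        (R.trans (Y-cong x z≈) (R.sym (x+M≈Y x (Y x z)))) (y₀-fixed x))))
      where z≈ = root⇒ x z hz≈0

    -- If `z₀ x` is `c`, a nontrivial fixed point would be a zero of `h`, hence equal to `c`, which
    -- is impossible; so `q x` is exceptional. Otherwise `z₀ x` is itself a nontrivial fixed point.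
    Φ≈z₀ : ∀ x → Φ (q x) ≈ z₀ x
    Φ≈z₀ x = ≈-stable λ Φ≉z₀ → ¬¬-excluded-middle λ where
      (yes z₀≈c) → Φ≉z₀ (R.trans
        (exceptional x λ z nontrivial →
          let open IsNontrivialFixedPoint nontrivial in
          nontrivial⇒≉c ≉0 ≉1 (R.trans
            (root-unique x z
              (fixed⇒h≈0 (in-1 (q x)) (q≈1+3u x) z (u-unit x) ≉0 ≉1 fixed))
            z₀≈c))
        (R.sym z₀≈c))
      (no z₀≉c) → Φ≉z₀ (generic (q x) (z₀ x) record
        { fixed = h≈0⇒fixed (in-1 (q x)) (q≈1+3u x) (z₀ x) (h-z₀ x)
        ; ≉0    = proj₁ (≉c⇒nontrivial z₀≉c)
        ; ≉1    = proj₂ (≉c⇒nontrivial z₀≉c)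
        })

    isometry : ∀ {f} → (∀ x → f x IsThirdOf (Φ (q x) - c)) → IsIsometry f
    isometry {f} f-third = implicit-isometry M M-contractive λ x →
      R.trans (f≈y₀ x) (R.trans (y₀-fixed x)
        (mod⇒≈ λ n → mod-+ mod-refl
          (mod-pred (M-contractive mod-refl (≈⇒mod (R.sym (f≈y₀ x)))))))
      where
      f≈y₀ : ∀ x → f x ≈ y₀ x
      f≈y₀ x = 3*-cancel (R.trans (f-third x) (combination 1# (Φ≈z₀ x)
        (≗⇒≈ λ n → lem (approx (Φ (q x)) n) (approx c n) (approx (y₀ x) n))))
        where
        lem : ∀ p c y → (p ℤ.- c) ℤ.- + 3 ℤ.* y ≡ + 1 ℤ.* (p ℤ.- (c ℤ.+ + 3 ℤ.* y))
        lem = solve-∀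

  -- For `u = 1 + 3x`, `h = z - 1 + 3((z - 2)x + R)`, which gives `Y`. At `z = 1 + 3y` the
  -- difference `Y - x` becomes `-(3xy + R)`, and `R` contracts because `x` and `y` enter it only
  -- through `1 + 3x` and `1 + 3y`.
  isometry-4+9* : ∀ {f} → (∀ x → f x IsThirdOf (Φ (4+9* x) - 1#)) → IsIsometry f
  isometry-4+9* = Branch.isometry 1# 4+9* (λ x → 1# + ⟨ 3 ⟩ * x)
    (λ x z → - ((z - 1# - 1#) * x + remainder (1# + ⟨ 3 ⟩ * x) z))
    (λ x → ≗⇒≈ λ n → lem₁ (approx x n))
    (λ x → ≈1⇒unit (1+3*≈1 x))
    (λ x z p → combination 1# p (≗⇒≈ λ n →
        lem₂ (approx x n) (approx z n) (approx (remainder (1# + ⟨ 3 ⟩ * x) z) n)))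
    (λ x z p → combination 1# p (≗⇒≈ λ n →
        lem₃ (approx x n) (approx z n) (approx (remainder (1# + ⟨ 3 ⟩ * x) z) n)))
    (λ x p → R.-‿cong (R.+-cong (R.*-congʳ (R.+-congʳ (R.+-congʳ p)))
        (mod⇒≈ λ n → remainder-mod mod-refl (≈⇒mod p))))
    (λ {x} {x′} {y} {y′} p p′ →
        mod-trans (≈⇒mod (M≈ x y))
        (mod-trans
          (mod-neg (mod-+ (3*-mod (mod-* p p′))
            (remainder-mod (mod-+ mod-refl (3*-mod p)) (mod-+ mod-refl (3*-mod p′)))))
          (≈⇒mod (R.sym (M≈ x′ y′)))))
    (λ _ ≉1 → ≉1)
    (λ {y} ≉1 →
        (λ ≈0 → from-no (mod? {1#} {0#} {1})
          (mod-trans (mod-sym (1+3*≈1 y)) (≈⇒mod ≈0)))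
        , ≉1)
    (λ x → at-q₁ (4+9* x)
        (mod-∣ 2 (at-level (congruent (divides (approx x 2) (lem₄ (approx x 2)))))))
    where
    1+3*≈1 : ∀ x → 1# + ⟨ 3 ⟩ * x ≈ 1# [mod3^ 1 ]
    1+3*≈1 x = at-level (congruent (divides (approx x 1) (lem (approx x 1))))
      where
      lem : ∀ x → (+ 1 ℤ.+ + 3 ℤ.* x) ℤ.- + 1 ≡ x ℤ.* + 3
      lem = solve-∀
    lem₁ : ∀ x → + 4 ℤ.+ + 9 ℤ.* x ≡ + 1 ℤ.+ + 3 ℤ.* (+ 1 ℤ.+ + 3 ℤ.* x)
    lem₁ = solve-∀
    lem₂ : ∀ x z r →
      z ℤ.- (+ 1 ℤ.+ + 3 ℤ.* (ℤ.- ((z ℤ.- + 1 ℤ.- + 1) ℤ.* x ℤ.+ r))) ≡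
      + 1 ℤ.* (+ 1 ℤ.+ (z ℤ.- + 1 ℤ.- + 1) ℤ.* (+ 1 ℤ.+ + 3 ℤ.* x) ℤ.+ + 3 ℤ.* r ℤ.- + 0)
    lem₂ = solve-∀
    lem₃ : ∀ x z r →
      (+ 1 ℤ.+ (z ℤ.- + 1 ℤ.- + 1) ℤ.* (+ 1 ℤ.+ + 3 ℤ.* x) ℤ.+ + 3 ℤ.* r) ℤ.- + 0 ≡
      + 1 ℤ.* (z ℤ.- (+ 1 ℤ.+ + 3 ℤ.* (ℤ.- ((z ℤ.- + 1 ℤ.- + 1) ℤ.* x ℤ.+ r))))
    lem₃ = solve-∀
    M≈ : ∀ x y →
      - ((1# + ⟨ 3 ⟩ * y - 1# - 1#) * x + remainder (1# + ⟨ 3 ⟩ * x) (1# + ⟨ 3 ⟩ * y)) - x ≈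
      - (⟨ 3 ⟩ * (x * y) + remainder (1# + ⟨ 3 ⟩ * x) (1# + ⟨ 3 ⟩ * y))
    M≈ x y = ≗⇒≈ λ n → lem (approx x n) (approx y n)
      (approx (remainder (1# + ⟨ 3 ⟩ * x) (1# + ⟨ 3 ⟩ * y)) n)
      where
      lem : ∀ x y r →
        ℤ.- ((+ 1 ℤ.+ + 3 ℤ.* y ℤ.- + 1 ℤ.- + 1) ℤ.* x ℤ.+ r) ℤ.- x ≡
        ℤ.- (+ 3 ℤ.* (x ℤ.* y) ℤ.+ r)
      lem = solve-∀
    lem₄ : ∀ x → (+ 4 ℤ.+ + 9 ℤ.* x) ℤ.- + 4 ≡ x ℤ.* + 9
    lem₄ = solve-∀

  -- For `u = 2 + 3x`, `h = 2z - 3 + 3((z - 2)x + R)`. Writing `2z` as `3z - z` isolates `z` without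
  -- dividing by 2. At `z = 3y` the difference `Y - x` is `3(y + xy - x) - 1 + R`.
  isometry-7+9* : ∀ {f} → (∀ x → f x IsThirdOf (Φ (7+9* x) - 0#)) → IsIsometry f
  isometry-7+9* = Branch.isometry 0# 7+9* (λ x → ⟨ 2 ⟩ + ⟨ 3 ⟩ * x)
    (λ x z → z - 1# + ((z - 1# - 1#) * x + remainder (⟨ 2 ⟩ + ⟨ 3 ⟩ * x) z))
    (λ x → ≗⇒≈ λ n → lem₁ (approx x n))
    (λ x → ≈2⇒unit
        (at-level (congruent (divides (approx x 1) (lem₄ (approx x 1))))))
    (λ x z p → combination (- 1#) p (≗⇒≈ λ n →
        lem₂ (approx x n) (approx z n) (approx (remainder (⟨ 2 ⟩ + ⟨ 3 ⟩ * x) z) n)))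
    (λ x z p → combination (- 1#) p (≗⇒≈ λ n →
        lem₃ (approx x n) (approx z n) (approx (remainder (⟨ 2 ⟩ + ⟨ 3 ⟩ * x) z) n)))
    (λ x p → R.+-cong (R.+-congʳ p)
        (R.+-cong (R.*-congʳ (R.+-congʳ (R.+-congʳ p)))
          (mod⇒≈ λ n → remainder-mod mod-refl (≈⇒mod p))))
    (λ {x} {x′} {y} {y′} p p′ →
        mod-trans (≈⇒mod (M≈ x y))
        (mod-trans
          (mod-+ (mod-+ (3*-mod (mod-+ (mod-+ p′ (mod-* p p′)) (mod-neg p))) mod-refl)
            (remainder-mod (mod-+ mod-refl (3*-mod p)) (mod-+ mod-refl (3*-mod p′))))
          (≈⇒mod (R.sym (M≈ x′ y′)))))
    (λ ≉0 _ → ≉0)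
    (λ {y} ≉0 → ≉0 ,
        (λ ≈1 → from-no (mod? {0#} {1#} {1})
          (mod-trans
            (at-level (~-sym (congruent (divides (approx y 1) (lem₅ (approx y 1))))))
            (≈⇒mod ≈1))))
    (λ x → at-q₀ (7+9* x)
        (mod-∣ 2 (at-level (congruent (divides (approx x 2) (lem₆ (approx x 2)))))))
    where
    lem₁ : ∀ x → + 7 ℤ.+ + 9 ℤ.* x ≡ + 1 ℤ.+ + 3 ℤ.* (+ 2 ℤ.+ + 3 ℤ.* x)
    lem₁ = solve-∀
    lem₂ : ∀ x z r →
      z ℤ.- (+ 0 ℤ.+ + 3 ℤ.* (z ℤ.- + 1 ℤ.+ ((z ℤ.- + 1 ℤ.- + 1) ℤ.* x ℤ.+ r))) ≡
      (ℤ.- + 1) ℤ.*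
        (+ 1 ℤ.+ (z ℤ.- + 1 ℤ.- + 1) ℤ.* (+ 2 ℤ.+ + 3 ℤ.* x) ℤ.+ + 3 ℤ.* r ℤ.- + 0)
    lem₂ = solve-∀
    lem₃ : ∀ x z r →
      (+ 1 ℤ.+ (z ℤ.- + 1 ℤ.- + 1) ℤ.* (+ 2 ℤ.+ + 3 ℤ.* x) ℤ.+ + 3 ℤ.* r) ℤ.- + 0 ≡
      (ℤ.- + 1) ℤ.*
        (z ℤ.- (+ 0 ℤ.+ + 3 ℤ.* (z ℤ.- + 1 ℤ.+ ((z ℤ.- + 1 ℤ.- + 1) ℤ.* x ℤ.+ r))))
    lem₃ = solve-∀
    lem₄ : ∀ x → (+ 2 ℤ.+ + 3 ℤ.* x) ℤ.- + 2 ≡ x ℤ.* + 3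
    lem₄ = solve-∀
    lem₅ : ∀ y → (+ 0 ℤ.+ + 3 ℤ.* y) ℤ.- + 0 ≡ y ℤ.* + 3
    lem₅ = solve-∀
    lem₆ : ∀ x → (+ 7 ℤ.+ + 9 ℤ.* x) ℤ.- + 7 ≡ x ℤ.* + 9
    lem₆ = solve-∀
    M≈ : ∀ x y →
      0# + ⟨ 3 ⟩ * y - 1# +
        ((0# + ⟨ 3 ⟩ * y - 1# - 1#) * x + remainder (⟨ 2 ⟩ + ⟨ 3 ⟩ * x) (0# + ⟨ 3 ⟩ * y)) - x ≈
      ⟨ 3 ⟩ * (y + x * y - x) - 1# + remainder (⟨ 2 ⟩ + ⟨ 3 ⟩ * x) (0# + ⟨ 3 ⟩ * y)
    M≈ x y = ≗⇒≈ λ n → lem (approx x n) (approx y n)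
      (approx (remainder (⟨ 2 ⟩ + ⟨ 3 ⟩ * x) (0# + ⟨ 3 ⟩ * y)) n)
      where
      lem : ∀ x y r →
        + 0 ℤ.+ + 3 ℤ.* y ℤ.- + 1 ℤ.+
          ((+ 0 ℤ.+ + 3 ℤ.* y ℤ.- + 1 ℤ.- + 1) ℤ.* x ℤ.+ r) ℤ.- x ≡
        + 3 ℤ.* (y ℤ.+ x ℤ.* y ℤ.- x) ℤ.- + 1 ℤ.+ r
      lem = solve-∀

theorem6p6 : (Φ : U¹-U² → ℤ₃) → IsFixedPointMap Φ →
    (F G : ℤ₃ → ℤ₃) →
    (∀ x → F x IsThirdOf (Φ (4+9* x) - 1#)) →
    (∀ x → G x IsThirdOf Φ (7+9* x)) →
    IsIsometry F × IsIsometry G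
theorem6p6 Φ Φ-fixed F G F-third G-third =
    isometry-4+9* Φ Φ-fixed F-third
  , isometry-7+9* Φ Φ-fixed (λ x → R.trans (G-third x)
      (≗⇒≈ λ n → sym (ℤ.+-identityʳ (approx (Φ (7+9* x)) n))))
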